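{- Let $F=\breve F(\alpha_1,\dots,\alpha_t)$ be a fence, let $i\in[t]$ with $\alpha_i\ge 2$, let $x\in\breve S_i$, let $v$ be the valley of $S_i$ (if it exists) and $p$ the peak of $S_i$ (if it exists), and put $y=s_{(i,1)}$, $z=s_{(i,\beta_i)}$. Then, as functions on $\mathcal J(F)$, \[ \alpha_i\chi_x+\chi_v+\chi_p=1-T_v-\sum_{y\trianglelefteq u\trianglelefteq x}\#[y,u]\,T_u+\sum_{x\vartriangleleft u\trianglelefteq z}\#[u,z]\,T_u , \] where $[a,b]=\{w\in F: a\trianglelefteq w\trianglelefteq b\}$ is an interval of $F$.
   Context: Fences: let $\alpha=(\alpha_1,\dots,\alpha_t)$ be positive integers with $t\ge2$ and $\alpha_1,\alpha_t\ge2$. Put $a_0=0$, $a_i=\alpha_1+\dots+\alpha_i$, $n=a_t-1$. The fence $\breve F(\alpha)$ is the poset (order $\trianglelefteq$) on $\{x_1,\dots,x_n\}$ whose cover relations are: for $1\le j\le n-1$ with $a_{i-1}\le j<a_i$, $x_j\lessdot x_{j+1}$ if $i$ is odd and $x_j\gtrdot x_{j+1}$ if $i$ is even. Segments: $S_1=\{x_j:1\le j\le a_1\}$, $S_i=\{x_j:a_{i-1}\le j\le a_i\}$ for $2\le i\le t-1$, $S_t=\{x_j:a_{t-1}\le j\le n\}$ (each a chain). The shared elements are $s_i=x_{a_i}$, $i\in[t-1]$; $s_i$ is a peak (covers two elements) for $i$ odd and a valley (is covered by two elements) for $i$ even. The peak (valley) of $S_i$ is the shared element of $S_i$ that is a peak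 (valley), if any. $\breve S_i$ is the set of unshared elements of $S_i$; $\beta_i=\#\breve S_i=\alpha_i-1$; $s_{(i,j)}$ is the $j$-th smallest element of $\breve S_i$ in the order of $F$. $\mathcal J(F)$ is the set of order ideals. For $q\in F$ and $I\in\mathcal J(F)$: $\chi_q(I)=1$ if $q\in\max(I)$ and $0$ otherwise; $T_q(I)=1$ if $q\notin I$ and $I\cup\{q\}$ is an ideal (i.e. $q\in\min(F\setminus I)$), $T_q(I)=-1$ if $q\in\max(I)$, and $T_q(I)=0$ otherwise. Convention: any statistic indexed by a nonexistent element (e.g. the valley of a segment with no valley) is identically zero. -}

module Defs where

open import Level using (0ℓ)
open import Data.Bool.Base using (if_then_else_)
open import Data.Fin.Base using (Fin; toℕ; fromℕ<)
import Data.Fin.Properties as Fin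
open import Data.Fin.Properties using (any?; all?; toℕ-injective; toℕ<n; toℕ-fromℕ<)
open import Data.Fin.Subset using (Subset; _∈_; _∉_; _∩_; _∪_; _─_; ⁅_⁆; ∣_∣)
open import Data.Fin.Subset.Properties using (_∈?_)
open import Data.Integer.Base using (ℤ; 0ℤ; 1ℤ; -1ℤ)
import Data.Integer.Properties as ℤ
open import Data.List.Base as List using (List; []; _∷_)
open import Data.Maybe.Base as Maybe using (Maybe; maybe′)
open import Data.Nat.Base
  using (ℕ; zero; suc; _+_; _∸_; _≤_; _<_; z≤n; s≤s; s≤s⁻¹; parity)
import Data.Nat.ListAction as ListAction
import Data.Nat.Properties as ℕ
open import Data.Nat.Properties using
  ( _≤?_; _<?_; ≤-refl; ≤-reflexive; ≤-trans; ≤-antisym; <-irrefl; <-cmp; <-≤-trans; ≤-<-trans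
  ; ≮⇒≥; n≤1+n; m≤n+m; m≤n⇒m<n∨m≡n; m∸n+n≡m; suc-injective; +-suc; +-monoʳ-≤; allUpTo? )
open import Data.Parity.Base using (Parity; 0ℙ; 1ℙ)
import Data.Parity.Properties as Parity
open import Data.Product.Base using (Σ; ∃-syntax; _×_; _,_; proj₁)
open import Data.Sum.Base using (_⊎_; inj₁; inj₂)
open import Data.Vec.Base as Vec using (Vec; lookup; tabulate; toList)
open import Function.Base using (_∘_; const; case_of_)
open import Relation.Binary.Core using (Rel)
open import Relation.Binary.Construct.Closure.ReflexiveTransitive using (Star; ε; _◅_; _◅◅_)
open import Relation.Binary.Construct.Closure.ReflexiveTransitive.Properties using (isPreorder)
import Relation.Binary.Definitions as B
open import Relation.Binary.Definitions using (tri<; tri≈; tri>)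
open import Relation.Binary.PropositionalEquality
  using (_≡_; _≢_; refl; sym; trans; cong; subst)
open import Relation.Binary.Structures using (IsDecPartialOrder)
open import Relation.Nullary using (¬_; Dec; yes; no; does; contradiction)
open import Relation.Nullary.Decidable
  using (map′; _×-dec_; _⊎-dec_; _→-dec_; ¬?; dec⇒maybe)
open import Relation.Unary using (Pred; Decidable)

open import Algebra.Properties.CommutativeMonoid.Sum ℤ.+-0-commutativeMonoid using (sum)

⟦_⟧ : ∀ {n} {P : Pred (Fin n) 0ℓ} → Decidable P → Subset n
⟦ P? ⟧ = tabulate (λ q → does (P? q))

∑-syntax : ∀ {n} → Subset n → (Fin n → ℤ) → ℤ
∑-syntax U f = sum (λ u → if lookup U u then f u else 0ℤ)

syntax ∑-syntax U (λ u → e) = ∑[ u ∈ U ] e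

-- Only used where at most one element satisfies the predicate.
the : ∀ {n} {P : Pred (Fin n) 0ℓ} → Decidable P → Maybe (Fin n)
the P? = Maybe.map proj₁ (dec⇒maybe (any? P?))

module FinitePoset {n : ℕ} {_⊴_ : Rel (Fin n) 0ℓ} (isDPO : IsDecPartialOrder _≡_ _⊴_) where

  open IsDecPartialOrder isDPO using () renaming (_≤?_ to _⊴?_)

  _◁_ : Rel (Fin n) 0ℓ
  q ◁ r = q ⊴ r × q ≢ r

  _◁?_ : B.Decidable _◁_
  q ◁? r = (q ⊴? r) ×-dec ¬? (q Fin.≟ r)

  [_,_] : Fin n → Fin n → Subset n
  [ q , r ] = ⟦ (λ w → (q ⊴? w) ×-dec (w ⊴? r)) ⟧

  ⦅_,_] : Fin n → Fin n → Subset n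
  ⦅ q , r ] = ⟦ (λ w → (q ◁? w) ×-dec (w ⊴? r)) ⟧

  -- Meaningful when U is a chain: q is the j-th smallest element of U (counting from 1).
  NthSmallest : ℕ → Subset n → Fin n → Set
  NthSmallest j U q = q ∈ U × ∣ U ∩ ⟦ _⊴? q ⟧ ∣ ≡ j

  IsIdeal : Subset n → Set
  IsIdeal I = ∀ q r → r ∈ I → q ⊴ r → q ∈ I

  isIdeal? : Decidable IsIdeal
  isIdeal? I = all? λ q → all? λ r → (r ∈? I) →-dec ((q ⊴? r) →-dec (q ∈? I))

  𝒥 : Set
  𝒥 = Σ (Subset n) IsIdeal

  IsMax : Subset n → Fin n → Set
  IsMax I q = q ∈ I × (∀ r → r ∈ I → q ⊴ r → q ≡ r)

  isMax? : ∀ I → Decidable (IsMax I)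
  isMax? I q = (q ∈? I) ×-dec all? λ r → (r ∈? I) →-dec ((q ⊴? r) →-dec (q Fin.≟ r))

  Addable : Subset n → Fin n → Set
  Addable I q = q ∉ I × IsIdeal (I ∪ ⁅ q ⁆)

  addable? : ∀ I → Decidable (Addable I)
  addable? I q = ¬? (q ∈? I) ×-dec isIdeal? (I ∪ ⁅ q ⁆)

  χ : Fin n → 𝒥 → ℤ
  χ q (I , _) = if does (isMax? I q) then 1ℤ else 0ℤ

  T : Fin n → 𝒥 → ℤ
  T q (I , _) =
    if does (addable? I q) then 1ℤ else
    if does (isMax? I q)   then -1ℤ else 0ℤ

  -- A statistic indexed by a nonexistent element is identically zero.
  χ′ T′ : Maybe (Fin n) → 𝒥 → ℤ
  χ′ = maybe′ χ (const 0ℤ)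
  T′ = maybe′ T (const 0ℤ)

record IsFenceShape {m : ℕ} (α : Vec ℕ (2 + m)) : Set where
  field
    positive : ∀ i → 1 ≤ lookup α i
    first≥2  : 2 ≤ Vec.head α
    last≥2   : 2 ≤ Vec.last α

-- Vectors and Fin count from 0, so i : Fin t stands for the index toℕ i + 1,
-- and q : Fin n stands for x_{pos q}.
module Fence {m : ℕ} (α : Vec ℕ (2 + m)) where

  t : ℕ
  t = 2 + m

  a : ℕ → ℕ
  a k = ListAction.sum (List.take k (toList α))

  n : ℕ
  n = a t ∸ 1

  pos : Fin n → ℕ
  pos q = suc (toℕ q)

  -- j lies in the block a_{i-1} ≤ j < a_i of some i of the given parity.
  Block : Parity → ℕ → Set
  Block π j = ∃[ i ] parity (suc (toℕ {t} i)) ≡ π × a (toℕ i) ≤ j × j < a (suc (toℕ i))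

  infix 4 _⋖_ _⊴_ _⊴?_

  -- For j = pos q (resp. pos r): x_j ⋖ x_{j+1} in odd blocks, x_{j+1} ⋖ x_j in even ones.
  data _⋖_ (q r : Fin n) : Set where
    up   : Block 1ℙ (pos q) → pos r ≡ suc (pos q) → q ⋖ r
    down : Block 0ℙ (pos r) → pos q ≡ suc (pos r) → q ⋖ r

  _⊴_ : Rel (Fin n) 0ℓ
  _⊴_ = Star _⋖_

  block? : ∀ π → Decidable (Block π)
  block? π j = any? λ i →
    (parity (suc (toℕ i)) Parity.≟ π) ×-dec ((a (toℕ i) ≤? j) ×-dec (j <? a (suc (toℕ i))))

  _⋖?_ : B.Decidable _⋖_
  q ⋖? r = map′
    (λ { (inj₁ (b , e)) → up b e ; (inj₂ (b , e)) → down b e })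
    (λ { (up b e) → inj₁ (b , e) ; (down b e) → inj₂ (b , e) })
    ((block? 1ℙ (pos q) ×-dec (pos r ℕ.≟ suc (pos q))) ⊎-dec
     (block? 0ℙ (pos r) ×-dec (pos q ℕ.≟ suc (pos r))))

  sum-take-mono : ∀ (xs : List ℕ) {k l} → k ≤ l → ListAction.sum (List.take k xs) ≤ ListAction.sum (List.take l xs)
  sum-take-mono []       {zero}  {_}     _         = z≤n
  sum-take-mono []       {suc k} {suc l} _         = z≤n
  sum-take-mono (x ∷ xs) {zero}          _         = z≤n
  sum-take-mono (x ∷ xs) {suc k} {suc l} (s≤s k≤l) = +-monoʳ-≤ x (sum-take-mono xs k≤l)

  a-mono : ∀ {k l} → k ≤ l → a k ≤ a l
  a-mono = sum-take-mono (toList α)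

  blocks-disjoint : ∀ {j} → Block 1ℙ j → ¬ Block 0ℙ j
  blocks-disjoint (i , p , l , u) (i′ , p′ , l′ , u′) with <-cmp (toℕ i) (toℕ i′)
  ... | tri< i<i′ _ _ = <-irrefl refl (<-≤-trans u (≤-trans (a-mono i<i′) l′))
  ... | tri> _ _ i′<i = <-irrefl refl (<-≤-trans u′ (≤-trans (a-mono i′<i) l))
  ... | tri≈ _ i≡i′ _ with () ← trans (sym p) (trans (cong (parity ∘ suc) i≡i′) p′)

  -- Decidable description of ⊴: q ⊴ r holds exactly when the path from x_{pos q}
  -- to x_{pos r} consists of ascending steps, or is walked backwards along
  -- descending ones.
  Span : Parity → Fin n → Fin n → Set
  Span π q r = toℕ q ≤ toℕ r × (∀ {k} → k < toℕ r → toℕ q ≤ k → Block π (suc k))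

  Run : Rel (Fin n) 0ℓ
  Run q r = Span 1ℙ q r ⊎ Span 0ℙ r q

  span? : ∀ π → B.Decidable (Span π)
  span? π q r = (toℕ q ≤? toℕ r) ×-dec
    allUpTo? (λ k → (toℕ q ≤? k) →-dec block? π (suc k)) (toℕ r)

  run? : B.Decidable Run
  run? q r = span? 1ℙ q r ⊎-dec span? 0ℙ r q

  span-one : ∀ {π} {q r : Fin n} → toℕ r ≡ suc (toℕ q) → Block π (pos q) → Span π q r
  span-one {π} {q} e b = ≤-trans (n≤1+n _) (≤-reflexive (sym e)) , λ k<r q≤k →
    subst (Block π ∘ suc) (≤-antisym q≤k (s≤s⁻¹ (≤-trans k<r (≤-reflexive e)))) b

  span-trans : ∀ {π} {q r s} → Span π q r → Span π r s → Span π q s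
  span-trans {r = r} (q≤r , f) (r≤s , g) = ≤-trans q≤r r≤s , λ {k} k<s q≤k → case (k <? toℕ r) of λ where
    (yes k<r) → f k<r q≤k
    (no  k≮r) → g k<s (≮⇒≥ k≮r)

  span-disjoint : ∀ {q r s s′} → toℕ q < toℕ s → toℕ r < toℕ s′ →
                  toℕ q ≡ toℕ r → Span 1ℙ q s → ¬ Span 0ℙ r s′
  span-disjoint q<s r<s′ e (_ , f) (_ , g) =
    blocks-disjoint (f q<s ≤-refl) (subst (Block 0ℙ ∘ suc) (sym e) (g r<s′ ≤-refl))

  ⊴⇒Run : ∀ {q r} → q ⊴ r → Run q r
  ⊴⇒Run ε = inj₁ (≤-refl , λ k<q q≤k → contradiction (<-≤-trans k<q q≤k) (<-irrefl refl))
  ⊴⇒Run (_◅_ {j = s} (up b e) p) with ⊴⇒Run p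
  ... | inj₁ asc = inj₁ (span-trans (span-one (suc-injective e) b) asc)
  ... | inj₂ (r≤s , g) with m≤n⇒m<n∨m≡n r≤s
  ...   | inj₁ r<s = contradiction
            (g (≤-reflexive (sym (suc-injective e))) (s≤s⁻¹ (≤-trans r<s (≤-reflexive (suc-injective e)))))
            (blocks-disjoint b)
  ...   | inj₂ r≡s = inj₁ (span-one (trans r≡s (suc-injective e)) b)
  ⊴⇒Run (_◅_ {j = s} (down b e) p) with ⊴⇒Run p
  ... | inj₂ desc = inj₂ (span-trans desc (span-one (suc-injective e) b))
  ... | inj₁ (s≤r , f) with m≤n⇒m<n∨m≡n s≤r
  ...   | inj₁ s<r = contradiction b (blocks-disjoint (f s<r ≤-refl))
  ...   | inj₂ s≡r = inj₂ (subst (λ k → Span 0ℙ k _) (toℕ-injective s≡r) (span-one (suc-injective e) b))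

  asc⇒⊴ : ∀ d {q r} → toℕ r ≡ d + toℕ q → Span 1ℙ q r → q ⊴ r
  asc⇒⊴ zero    e _ = subst (_ ⊴_) (sym (toℕ-injective e)) ε
  asc⇒⊴ (suc d) {q} {r} e (_ , f) =
    up (f q<r ≤-refl) (cong suc e′) ◅
    asc⇒⊴ d (trans e (trans (sym (+-suc d _)) (cong (d +_) (sym e′))))
      (≤-trans (≤-reflexive e′) q<r , λ k<r s≤k → f k<r (≤-trans (n≤1+n _) (≤-trans (≤-reflexive (sym e′)) s≤k)))
    where
    q<r : toℕ q < toℕ r
    q<r = ≤-trans (s≤s (m≤n+m _ d)) (≤-reflexive (sym e))
    s<n = ≤-<-trans q<r (toℕ<n r)
    e′ : toℕ (fromℕ< s<n) ≡ suc (toℕ q)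
    e′ = toℕ-fromℕ< s<n

  desc⇒⊴ : ∀ d {q r} → toℕ q ≡ d + toℕ r → Span 0ℙ r q → q ⊴ r
  desc⇒⊴ zero    e _ = subst (_⊴ _) (sym (toℕ-injective e)) ε
  desc⇒⊴ (suc d) {q} {r} e (_ , g) =
    desc⇒⊴ d (trans e (trans (sym (+-suc d _)) (cong (d +_) (sym e′))))
      (≤-trans (≤-reflexive e′) r<q , λ k<q s≤k → g k<q (≤-trans (n≤1+n _) (≤-trans (≤-reflexive (sym e′)) s≤k)))
    ◅◅ (down (g r<q ≤-refl) (cong suc e′) ◅ ε)
    where
    r<q : toℕ r < toℕ q
    r<q = ≤-trans (s≤s (m≤n+m _ d)) (≤-reflexive (sym e))
    s<n = ≤-<-trans r<q (toℕ<n q)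
    e′ : toℕ (fromℕ< s<n) ≡ suc (toℕ r)
    e′ = toℕ-fromℕ< s<n

  Run⇒⊴ : ∀ {q r} → Run q r → q ⊴ r
  Run⇒⊴ (inj₁ s@(q≤r , _)) = asc⇒⊴  _ (sym (m∸n+n≡m q≤r)) s
  Run⇒⊴ (inj₂ s@(r≤q , _)) = desc⇒⊴ _ (sym (m∸n+n≡m r≤q)) s

  Run-antisym : ∀ {q r} → Run q r → Run r q → q ≡ r
  Run-antisym (inj₁ (q≤r , _)) (inj₁ (r≤q , _)) = toℕ-injective (≤-antisym q≤r r≤q)
  Run-antisym (inj₂ (r≤q , _)) (inj₂ (q≤r , _)) = toℕ-injective (≤-antisym q≤r r≤q)
  Run-antisym (inj₁ s@(q≤r , _)) (inj₂ s′) with m≤n⇒m<n∨m≡n q≤r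
  ... | inj₁ q<r = contradiction s′ (span-disjoint q<r q<r refl s)
  ... | inj₂ q≡r = toℕ-injective q≡r
  Run-antisym (inj₂ s′@(r≤q , _)) (inj₁ s) with m≤n⇒m<n∨m≡n r≤q
  ... | inj₁ r<q = contradiction s′ (span-disjoint r<q r<q refl s)
  ... | inj₂ r≡q = sym (toℕ-injective r≡q)

  _⊴?_ : B.Decidable _⊴_
  q ⊴? r = map′ Run⇒⊴ ⊴⇒Run (run? q r)

  isDecPartialOrder : IsDecPartialOrder _≡_ _⊴_
  isDecPartialOrder = record
    { isPartialOrder = record
      { isPreorder = isPreorder _⋖_
      ; antisym    = λ p q → Run-antisym (⊴⇒Run p) (⊴⇒Run q)
      }
    ; _≟_  = Fin._≟_
    ; _≤?_ = _⊴?_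
    }

  open FinitePoset isDecPartialOrder public

  -- Since 1 ≤ pos q ≤ n = a_t - 1, the uniform bounds a_{i-1} ≤ pos q ≤ a_i
  -- also give the truncated first and last segments.
  S : Fin t → Subset n
  S i = ⟦ (λ q → (a (toℕ i) ≤? pos q) ×-dec (pos q ≤? a (suc (toℕ i)))) ⟧

  -- The elements s_k = x_{a_k} for 1 ≤ k ≤ t - 1.
  shared : Subset n
  shared = ⟦ (λ q → any? {n = suc m} λ k → pos q ℕ.≟ a (suc (toℕ k))) ⟧

  S̆ : Fin t → Subset n
  S̆ i = S i ─ shared

  β : Fin t → ℕ
  β i = ∣ S̆ i ∣

  IsPeak IsValley : Pred (Fin n) 0ℓ
  IsPeak   q = ∃[ w ] ∃[ w′ ] w ≢ w′ × w ⋖ q × w′ ⋖ q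
  IsValley q = ∃[ w ] ∃[ w′ ] w ≢ w′ × q ⋖ w × q ⋖ w′

  isPeak? : Decidable IsPeak
  isPeak? q = any? λ w → any? λ w′ → ¬? (w Fin.≟ w′) ×-dec ((w ⋖? q) ×-dec (w′ ⋖? q))

  isValley? : Decidable IsValley
  isValley? q = any? λ w → any? λ w′ → ¬? (w Fin.≟ w′) ×-dec ((q ⋖? w) ×-dec (q ⋖? w′))

  peak valley : Fin t → Maybe (Fin n)
  peak   i = the (λ q → (q ∈? S i ∩ shared) ×-dec isPeak? q)
  valley i = the (λ q → (q ∈? S i ∩ shared) ×-dec isValley? q)

{-# OPTIONS --safe #-}

-- For an ideal I let E 0, …, E (ℓ + 1) be the indicators of membership in I along
-- v, s_{(i,1)}, …, s_{(i,ℓ)}, p, where ℓ = β_i, a missing v counts as present and a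
-- missing p as absent.  The unshared elements of a segment have no covers other than
-- their neighbours in it, so T of the j-th one is the second difference
-- E (j - 1) - 2 E j + E (j + 1), and χ of it is E j - E (j + 1).  Moreover
-- χ_p = E (ℓ + 1) and T_v + χ_v = 1 - E 0.  The interval sizes are the affine weights
-- j and ℓ + 1 - j, so both sums telescope and the claim becomes a linear identity in E.
module Submission where

open import Defs
open import Level using (0ℓ)
open import Data.Bool.Base using (true; false; if_then_else_)
open import Data.Fin.Base using (Fin; zero; suc; toℕ; fromℕ<)
import Data.Fin.Properties as Fin
open import Data.Fin.Subset using (Subset; _∈_; _∉_; _∩_; _∪_; _─_; ⁅_⁆; ∣_∣)
open import Data.Fin.Subset.Properties
  using (_∈?_; p⊆p∪q; q⊆p∪q; x∈p∪q⁻; x∈⁅x⁆; x∈⁅y⁆⇒x≡y; x∈p∩q⁺; x∈p∩q⁻; p─q⊆p; x∈p∧x∉q⇒x∈p─q)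
open import Data.Integer.Base using (ℤ; 0ℤ; 1ℤ; -1ℤ; +_; _+_; _-_; _*_; _⊖_)
import Data.Integer.Properties as ℤ
open import Data.Integer.Tactic.RingSolver using (solve-∀)
open import Data.List.Base using (take)
open import Data.Maybe.Base using (Maybe; just; nothing; maybe′)
open import Data.Maybe.Properties using (just-injective)
open import Data.Nat.Base as ℕ using (ℕ; zero; suc; _∸_; _≤_; _<_; z≤n; s≤s; s≤s⁻¹; z<s; parity)
import Data.Nat.ListAction as ListAction
import Data.Nat.Properties as ℕ
open import Data.Parity.Base using (Parity; 0ℙ; 1ℙ; _⁻¹)
open import Data.Parity.Properties using (suc-homo-⁻¹)
open import Data.Product.Base using (∃-syntax; _×_; _,_; proj₁; proj₂)
open import Data.Sum.Base using (_⊎_; inj₁; inj₂; swap)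
open import Data.Vec.Base as Vec using (Vec; lookup; []; _∷_; toList)
open import Data.Vec.Properties using ([]=⇒lookup; lookup⇒[]=; lookup∘tabulate)
open import Function.Base using (_∘_; flip; const)
open import Relation.Binary.Core using (Rel)
open import Relation.Binary.PropositionalEquality
  using (_≡_; _≢_; refl; sym; trans; cong; cong₂; subst; subst₂; module ≡-Reasoning)
open import Relation.Binary.Structures using (IsDecPartialOrder)
open import Relation.Nullary using (¬_; Dec; yes; no; does; contradiction)
open import Relation.Nullary.Decidable using (dec-true; dec-false; _×-dec_)
open import Relation.Unary using (Pred; Decidable)

open import Algebra.Properties.CommutativeMonoid.Sum ℤ.+-0-commutativeMonoid
  using (sum; ∑-comm; sum-cong-≗; sum-replicate-zero)

-- Indicators and finite sums.

does⇒ : ∀ {A : Set} (A? : Dec A) → does A? ≡ true → A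
does⇒ (yes a) _ = a

∈⟦⟧⁺ : ∀ {n} {P : Pred (Fin n) 0ℓ} (P? : Decidable P) {q} → P q → q ∈ ⟦ P? ⟧
∈⟦⟧⁺ P? {q} Pq = lookup⇒[]= q _ (trans (lookup∘tabulate _ q) (dec-true (P? q) Pq))

∈⟦⟧⁻ : ∀ {n} {P : Pred (Fin n) 0ℓ} (P? : Decidable P) {q} → q ∈ ⟦ P? ⟧ → P q
∈⟦⟧⁻ P? {q} q∈ = does⇒ (P? q) (trans (sym (lookup∘tabulate _ q)) ([]=⇒lookup q∈))

𝟙 : {A : Set} → Dec A → ℤ
𝟙 A? = if does A? then 1ℤ else 0ℤ

𝟙-yes : ∀ {A : Set} (A? : Dec A) → A → 𝟙 A? ≡ 1ℤ
𝟙-yes A? a = cong (if_then 1ℤ else 0ℤ) (dec-true A? a)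

𝟙-no : ∀ {A : Set} (A? : Dec A) → ¬ A → 𝟙 A? ≡ 0ℤ
𝟙-no A? ¬a = cong (if_then 1ℤ else 0ℤ) (dec-false A? ¬a)

sum-zero : ∀ {n} (f : Fin n → ℤ) → (∀ u → f u ≡ 0ℤ) → sum f ≡ 0ℤ
sum-zero {n} f f≡0 = trans (sum-cong-≗ f≡0) (sum-replicate-zero n)

sum-single : ∀ {n} (f : Fin n → ℤ) w → (∀ u → u ≢ w → f u ≡ 0ℤ) → sum f ≡ f w
sum-single f zero f≡0 =
  trans (cong (λ k → f zero + k) (sum-zero (f ∘ suc) (λ u → f≡0 (suc u) (λ ())))) (ℤ.+-identityʳ _)
sum-single f (suc w) f≡0 =
  trans (cong₂ _+_ (f≡0 zero (λ ())) (sum-single (f ∘ suc) w (λ u u≢w → f≡0 (suc u) (u≢w ∘ Fin.suc-injective))))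
        (ℤ.+-identityˡ _)

-- Each `f u` with `u ∈ V` is spread over the row `δ u`, whose only possible nonzero entry sits at
-- the one index hitting `u`. After exchanging the two sums, each column reduces to the entry
-- `f (c j)`.
∑-enumerate : ∀ {n k} (c : Fin k → Fin n) → (∀ {i j} → c i ≡ c j → i ≡ j) →
              (V : Subset n) → (∀ j → c j ∈ V) → (∀ {u} → u ∈ V → ∃[ j ] u ≡ c j) →
              ∀ f → (∑[ u ∈ V ] f u) ≡ sum (f ∘ c)
∑-enumerate {n} {k} c c-inj V c∈V V⊆c f = begin
  (∑[ u ∈ V ] f u)             ≡⟨ sum-cong-≗ (λ u → row u (u ∈? V)) ⟩
  sum (λ u → sum (δ u))        ≡⟨ ∑-comm δ ⟩
  sum (λ j → sum (flip δ j))   ≡⟨ sum-cong-≗ column ⟩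
  sum (f ∘ c)                  ∎
  where
  open ≡-Reasoning
  δ : Fin n → Fin k → ℤ
  δ u j = if does (u Fin.≟ c j) then f u else 0ℤ
  δ-≡ : ∀ {u j} → u ≡ c j → δ u j ≡ f u
  δ-≡ {u} {j} e = cong (if_then f u else 0ℤ) (dec-true (u Fin.≟ c j) e)
  δ-≢ : ∀ {u j} → u ≢ c j → δ u j ≡ 0ℤ
  δ-≢ {u} {j} e = cong (if_then f u else 0ℤ) (dec-false (u Fin.≟ c j) e)
  row : ∀ u → Dec (u ∈ V) → (if lookup V u then f u else 0ℤ) ≡ sum (δ u)
  row u (yes u∈V) with V⊆c u∈V
  ... | j , u≡cj = trans (cong (if_then f u else 0ℤ) ([]=⇒lookup u∈V))
    (sym (trans (sum-single (δ u) j (λ j′ j′≢j → δ-≢ (λ e → j′≢j (c-inj (trans (sym e) u≡cj))))) (δ-≡ u≡cj)))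
  row u (no u∉V) = trans (cong (if_then f u else 0ℤ) outside)
    (sym (sum-zero (δ u) (λ j → δ-≢ (λ e → u∉V (subst (_∈ V) (sym e) (c∈V j))))))
    where
    outside : lookup V u ≡ false
    outside with lookup V u in eq
    ... | true  = contradiction (lookup⇒[]= u V eq) u∉V
    ... | false = refl
  column : ∀ j → sum (flip δ j) ≡ f (c j)
  column j = trans (sum-single (flip δ j) (c j) (λ u → δ-≢)) (δ-≡ refl)

∣∣≡∑1 : ∀ {n} (V : Subset n) → + ∣ V ∣ ≡ (∑[ u ∈ V ] 1ℤ)
∣∣≡∑1 []          = refl
∣∣≡∑1 (true ∷ V)  = cong (λ k → 1ℤ + k) (∣∣≡∑1 V)
∣∣≡∑1 (false ∷ V) = trans (∣∣≡∑1 V) (sym (ℤ.+-identityˡ _))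

sum-1 : ∀ d → sum {d} (const 1ℤ) ≡ + d
sum-1 zero    = refl
sum-1 (suc d) = cong (λ k → 1ℤ + k) (sum-1 d)

-- Second differences with affine weights.

Δ² : (ℕ → ℤ) → ℕ → ℤ
Δ² E j = (E j - E (suc j)) - (E (suc j) - E (suc (suc j)))

-- Summation by parts: an affine weight has zero second difference, so only the terms at the two
-- ends survive. Peeling off `j = 0` replaces `w` by `w + s` and `E` by `E ∘ suc`.
∑-affine-Δ² : ∀ d (w s : ℤ) (E : ℕ → ℤ) →
  sum {d} (λ j → (w + s * + toℕ j) * Δ² E (toℕ j))
    ≡ w * E 0 - (w - s) * E 1 - (w + s * + d) * E d + (w + s * + d - s) * E (suc d)
∑-affine-Δ² zero w s E = base w s (E 0) (E 1)
  where
  base : ∀ w s a b → 0ℤ ≡ w * a - (w - s) * b - (w + s * 0ℤ) * a + (w + s * 0ℤ - s) * b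
  base = solve-∀
∑-affine-Δ² (suc d) w s E = begin
  (w + s * 0ℤ) * Δ² E 0 + sum {d} (λ j → (w + s * (1ℤ + + toℕ j)) * Δ² E (suc (toℕ j)))
    ≡⟨ cong₂ _+_ (cong (_* Δ² E 0) (zeroth w s)) (sum-cong-≗ {d} (λ j → cong (_* Δ² E (suc (toℕ j))) (shift w s (+ toℕ j)))) ⟩
  w * Δ² E 0 + sum {d} (λ j → (w + s + s * + toℕ j) * Δ² (E ∘ suc) (toℕ j))
    ≡⟨ cong (λ k → w * Δ² E 0 + k) (∑-affine-Δ² d (w + s) s (E ∘ suc)) ⟩
  w * Δ² E 0 + ((w + s) * E 1 - (w + s - s) * E 2 - (w + s + s * + d) * E (suc d) + (w + s + s * + d - s) * E (suc (suc d)))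
    ≡⟨ step w s (+ d) (E 0) (E 1) (E 2) (E (suc d)) (E (suc (suc d))) ⟩
  w * E 0 - (w - s) * E 1 - (w + s * (1ℤ + + d)) * E (suc d) + (w + s * (1ℤ + + d) - s) * E (suc (suc d)) ∎
  where
  open ≡-Reasoning
  zeroth : ∀ w s → w + s * 0ℤ ≡ w
  zeroth = solve-∀
  shift : ∀ w s j → w + s * (1ℤ + j) ≡ w + s + s * j
  shift = solve-∀
  step : ∀ w s d e₀ e₁ e₂ x y →
    w * ((e₀ - e₁) - (e₁ - e₂)) + ((w + s) * e₁ - (w + s - s) * e₂ - (w + s + s * d) * x + (w + s + s * d - s) * y)
      ≡ w * e₀ - (w - s) * e₁ - (w + s * (1ℤ + d)) * x + (w + s * (1ℤ + d) - s) * y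
  step = solve-∀

Δ²-shift : ∀ E l j → Δ² (λ i → E (l ℕ.+ i)) j ≡ Δ² E (l ℕ.+ j)
Δ²-shift E l j rewrite ℕ.+-suc l (suc j) | ℕ.+-suc l j = refl

-- The factor `-1ℤ` is kept so that the right side matches an affine weight of slope `-1ℤ`.
pos-∸ : ∀ {m n} → n ≤ m → + (m ∸ n) ≡ + m + -1ℤ * + n
pos-∸ {m} {n} n≤m = begin
  + (m ∸ n)          ≡⟨ ℤ.⊖-≥ n≤m ⟨
  m ⊖ n              ≡⟨ ℤ.m-n≡m⊖n m n ⟨
  + m - + n          ≡⟨ cong (λ k → + m + k) (ℤ.-1*i≡-i (+ n)) ⟨
  + m + -1ℤ * + n    ∎
  where open ≡-Reasoning

-- Chains with at most one bounding element at each end.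

-- L and R are the shared elements bounding the chain U from below and above, where they exist.
record Ladder {n} (_≼_ : Rel (Fin n) 0ℓ) (U : Subset n) (ℓ : ℕ) (L R : Maybe (Fin n)) : Set where
  field
    c       : ℕ → Fin n
    c∈U     : ∀ {j} → j < ℓ → c j ∈ U
    rung    : ∀ {u} → u ∈ U → ∃[ j ] j < ℓ × u ≡ c j
    mono    : ∀ {j k} → j ≤ k → k < ℓ → c j ≼ c k
    reflect : ∀ {j k} → j < ℓ → k < ℓ → c j ≼ c k → j ≤ k
    below   : ∀ {u w} → u ∈ U → w ≼ u → w ∈ U ⊎ L ≡ just w
    above   : ∀ {u w} → u ∈ U → u ≼ w → w ∈ U ⊎ R ≡ just w
    bottom  : ∀ {w} → L ≡ just w → w ∉ U × (∀ {u} → u ∈ U → w ≼ u) × (∀ {r} → r ≼ w → r ≡ w)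
    top     : ∀ {w} → R ≡ just w → w ∉ U × (∀ {u} → u ∈ U → u ≼ w) × (∀ {r} → w ≼ r → r ≡ w)

-- Serves the segments that descend from left to right: index `j` becomes `ℓ ∸ suc j` and the two
-- ends trade places.
reverse : ∀ {n} {_≼_ : Rel (Fin n) 0ℓ} {U ℓ L R} → Ladder _≼_ U ℓ L R → Ladder (flip _≼_) U ℓ R L
reverse {U = U} {ℓ} lad = record
  { c       = λ j → c (ℓ ∸ suc j)
  ; c∈U     = λ j<ℓ → c∈U (opp< j<ℓ)
  ; rung    = λ u∈U → let j , j<ℓ , u≡ = rung u∈U in
      ℓ ∸ suc j , opp< j<ℓ , trans u≡ (cong c (sym (opp-opp j<ℓ)))
  ; mono    = λ j≤k k<ℓ → mono (ℕ.∸-monoʳ-≤ ℓ (s≤s j≤k)) (opp< (ℕ.≤-<-trans j≤k k<ℓ))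
  ; reflect = λ j<ℓ k<ℓ r → s≤s⁻¹ (ℕ.∸-cancelʳ-≤ j<ℓ (reflect (opp< k<ℓ) (opp< j<ℓ) r))
  ; below   = above
  ; above   = below
  ; bottom  = top
  ; top     = bottom
  }
  where
  open Ladder lad
  opp< : ∀ {j} → j < ℓ → ℓ ∸ suc j < ℓ
  opp< {j} j<ℓ = ℕ.∸-monoʳ-< {ℓ} {suc j} {0} z<s j<ℓ
  opp-opp : ∀ {j} → j < ℓ → ℓ ∸ suc (ℓ ∸ suc j) ≡ j
  opp-opp {j} j<ℓ = ℕ.suc-injective (trans (sym (ℕ.+-∸-assoc 1 (opp< j<ℓ)))
    (ℕ.m∸[m∸n]≡n j<ℓ))

-- Addability and maximality as differences of membership indicators.

module Toggling {n} {_⊴_ : Rel (Fin n) 0ℓ} (isDPO : IsDecPartialOrder _≡_ _⊴_) where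

  open FinitePoset isDPO
  open IsDecPartialOrder isDPO using () renaming (refl to ⊴-refl; trans to ⊴-trans; _≤?_ to _⊴?_)

  e : 𝒥 → Fin n → ℤ
  e (I , _) q = 𝟙 (q ∈? I)

  A : Fin n → 𝒥 → ℤ
  A q (I , _) = 𝟙 (addable? I q)

  -- Addability needs `q ∉ I` and maximality needs `q ∈ I`, so the two nonzero cases of `T` exclude
  -- each other. The two parts then depend on lower and upper covers separately.
  T≡A-χ : ∀ q J → T q J ≡ A q J - χ q J
  T≡A-χ q (I , _) = go (addable? I q) (isMax? I q)
    where
    go : (A? : Dec (Addable I q)) (M? : Dec (IsMax I q)) →
         (if does A? then 1ℤ else if does M? then -1ℤ else 0ℤ) ≡ 𝟙 A? - 𝟙 M?
    go (yes (q∉I , _)) (yes (q∈I , _)) = contradiction q∈I q∉I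
    go (yes _) (no _)  = refl
    go (no _)  (yes _) = refl
    go (no _)  (no _)  = refl

  ∈[]⁻ : ∀ {q r w} → w ∈ [ q , r ] → q ⊴ w × w ⊴ r
  ∈[]⁻ {q} {r} = ∈⟦⟧⁻ (λ w → (q ⊴? w) ×-dec (w ⊴? r))

  ∈⦅]⁻ : ∀ {q r w} → w ∈ ⦅ q , r ] → q ◁ w × w ⊴ r
  ∈⦅]⁻ {q} {r} = ∈⟦⟧⁻ (λ w → (q ◁? w) ×-dec (w ⊴? r))

  ∈[]⁺ : ∀ {q r w} → q ⊴ w → w ⊴ r → w ∈ [ q , r ]
  ∈[]⁺ {q} {r} q⊴w w⊴r = ∈⟦⟧⁺ (λ w → (q ⊴? w) ×-dec (w ⊴? r)) (q⊴w , w⊴r)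

  ∈⦅]⁺ : ∀ {q r w} → q ◁ w → w ⊴ r → w ∈ ⦅ q , r ]
  ∈⦅]⁺ {q} {r} q◁w w⊴r = ∈⟦⟧⁺ (λ w → (q ◁? w) ×-dec (w ⊴? r)) (q◁w , w⊴r)

  addable-intro : ∀ {I q} → IsIdeal I → q ∉ I → (∀ {w} → w ◁ q → w ∈ I) → Addable I q
  addable-intro {I} {q} ideal q∉I below = q∉I , closed
    where
    closed : IsIdeal (I ∪ ⁅ q ⁆)
    closed w s s∈ w⊴s with x∈p∪q⁻ I ⁅ q ⁆ s∈
    ... | inj₁ s∈I = p⊆p∪q ⁅ q ⁆ (ideal w s s∈I w⊴s)
    ... | inj₂ s∈q with refl ← x∈⁅y⁆⇒x≡y q s∈q | w Fin.≟ q
    ...   | yes refl = q⊆p∪q I ⁅ q ⁆ (x∈⁅x⁆ q)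
    ...   | no w≢q   = p⊆p∪q ⁅ q ⁆ (below (w⊴s , w≢q))

  addable⇒∋ : ∀ {I q r} → Addable I q → r ◁ q → r ∈ I
  addable⇒∋ {I} {q} {r} (_ , ideal) (r⊴q , r≢q)
    with x∈p∪q⁻ I ⁅ q ⁆ (ideal r q (q⊆p∪q I ⁅ q ⁆ (x∈⁅x⁆ q)) r⊴q)
  ... | inj₁ r∈I = r∈I
  ... | inj₂ r∈q = contradiction (x∈⁅y⁆⇒x≡y q r∈q) r≢q

  -- Here `r` is the only lower cover of `q`, so `q` is addable exactly when `r ∈ I` and `q ∉ I`. As
  -- `q ∈ I` forces `r ∈ I`, the difference is the indicator of this.
  A-cover : ∀ J {q r} → r ◁ q → (∀ {w} → w ◁ q → w ⊴ r) → A q J ≡ e J r - e J q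
  A-cover (I , ideal) {q} {r} r◁q below = go (q ∈? I) (r ∈? I)
    where
    go : Dec (q ∈ I) → Dec (r ∈ I) → _
    go (yes q∈I) _ = trans (𝟙-no (addable? I q) (λ add → proj₁ add q∈I))
      (sym (cong₂ _-_ (𝟙-yes (r ∈? I) (ideal r q q∈I (proj₁ r◁q))) (𝟙-yes (q ∈? I) q∈I)))
    go (no q∉I) (yes r∈I) = trans
      (𝟙-yes (addable? I q) (addable-intro ideal q∉I (λ w◁q → ideal _ r r∈I (below w◁q))))
      (sym (cong₂ _-_ (𝟙-yes (r ∈? I) r∈I) (𝟙-no (q ∈? I) q∉I)))
    go (no q∉I) (no r∉I) = trans (𝟙-no (addable? I q) (λ add → r∉I (addable⇒∋ add r◁q)))
      (sym (cong₂ _-_ (𝟙-no (r ∈? I) r∉I) (𝟙-no (q ∈? I) q∉I)))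

  -- A minimal element behaves as if it had a lower cover lying in every ideal; hence the value `1ℤ`
  -- for a missing `v` later on.
  A-minimal : ∀ J {q} → (∀ {w} → w ⊴ q → w ≡ q) → A q J ≡ 1ℤ - e J q
  A-minimal (I , ideal) {q} min = go (q ∈? I)
    where
    go : Dec (q ∈ I) → _
    go (yes q∈I) = trans (𝟙-no (addable? I q) (λ add → proj₁ add q∈I))
      (sym (cong (λ k → 1ℤ - k) (𝟙-yes (q ∈? I) q∈I)))
    go (no q∉I) = trans
      (𝟙-yes (addable? I q) (addable-intro ideal q∉I (λ (w⊴q , w≢q) → contradiction (min w⊴q) w≢q)))
      (sym (cong (λ k → 1ℤ - k) (𝟙-no (q ∈? I) q∉I)))

  -- Dually, `r` is the only upper cover of `q`, so `q` is maximal in `I` exactly when `q ∈ I` and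
  -- `r ∉ I`.
  χ-cover : ∀ J {q r} → q ◁ r → (∀ {w} → q ◁ w → r ⊴ w) → χ q J ≡ e J q - e J r
  χ-cover (I , ideal) {q} {r} (q⊴r , q≢r) above = go (q ∈? I) (r ∈? I)
    where
    go : Dec (q ∈ I) → Dec (r ∈ I) → _
    go _ (yes r∈I) = trans (𝟙-no (isMax? I q) (λ max → q≢r (proj₂ max r r∈I q⊴r)))
      (sym (cong₂ _-_ (𝟙-yes (q ∈? I) (ideal q r r∈I q⊴r)) (𝟙-yes (r ∈? I) r∈I)))
    go (yes q∈I) (no r∉I) = trans (𝟙-yes (isMax? I q) (q∈I , max))
      (sym (cong₂ _-_ (𝟙-yes (q ∈? I) q∈I) (𝟙-no (r ∈? I) r∉I)))
      where
      max : ∀ w → w ∈ I → q ⊴ w → q ≡ w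
      max w w∈I q⊴w with q Fin.≟ w
      ... | yes q≡w = q≡w
      ... | no q≢w  = contradiction (ideal r w w∈I (above (q⊴w , q≢w))) r∉I
    go (no q∉I) (no r∉I) = trans (𝟙-no (isMax? I q) (λ max → q∉I (proj₁ max)))
      (sym (cong₂ _-_ (𝟙-no (q ∈? I) q∉I) (𝟙-no (r ∈? I) r∉I)))

  χ-maximal : ∀ J {q} → (∀ {w} → q ⊴ w → w ≡ q) → χ q J ≡ e J q
  χ-maximal (I , _) {q} max = go (q ∈? I)
    where
    go : Dec (q ∈ I) → _
    go (yes q∈I) = trans (𝟙-yes (isMax? I q) (q∈I , λ _ _ q⊴r → sym (max q⊴r))) (sym (𝟙-yes (q ∈? I) q∈I))
    go (no q∉I)  = trans (𝟙-no (isMax? I q) (λ m → q∉I (proj₁ m))) (sym (𝟙-no (q ∈? I) q∉I))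

  -- Toggle statistics along a ladder.

  module OnLadder {U ℓ v p} (ladder : Ladder _⊴_ U ℓ v p) where

    open Ladder ladder

    c-injective : ∀ {j k} → j < ℓ → k < ℓ → c j ≡ c k → j ≡ k
    c-injective j<ℓ k<ℓ e = ℕ.≤-antisym
      (reflect j<ℓ k<ℓ (subst (c _ ⊴_) e ⊴-refl)) (reflect k<ℓ j<ℓ (subst (_⊴ c _) e ⊴-refl))

    -- `V` is the image of the half-open index range from `l` to `h`; `bound` keeps the indices
    -- where `c` is injective.
    record Enumerates (V : Subset n) (l h : ℕ) : Set where
      field
        bound : h ≤ ℓ
        ⊇     : ∀ {j} → l ≤ j → j < h → c j ∈ V
        ⊆     : ∀ {u} → u ∈ V → ∃[ j ] l ≤ j × j < h × u ≡ c j

    ∑-range : ∀ {V l h} → Enumerates V l h → ∀ f →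
              (∑[ u ∈ V ] f u) ≡ sum {h ∸ l} (λ j → f (c (l ℕ.+ toℕ j)))
    ∑-range {V} {l} {h} enum f = ∑-enumerate (λ j → c (l ℕ.+ toℕ j))
      (λ {i} {j} e → Fin.toℕ-injective (ℕ.+-cancelˡ-≡ l _ _ (c-injective (ℕ.<-≤-trans (<h i) bound) (ℕ.<-≤-trans (<h j) bound) e)))
      V (λ j → ⊇ (ℕ.m≤m+n l _) (<h j)) index f
      where
      open Enumerates enum
      <h : (j : Fin (h ∸ l)) → l ℕ.+ toℕ j < h
      <h j = ℕ.≤-trans (ℕ.+-monoʳ-< l (Fin.toℕ<n j)) (ℕ.≤-reflexive (ℕ.m+[n∸m]≡n l≤h))
        where
        l≤h : l ≤ h
        -- An empty range may have `h < l`; here the index `j` itself witnesses that `h ∸ l` is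
        -- positive.
        l≤h = ℕ.<⇒≤ (ℕ.m∸n≢0⇒n<m (ℕ.m<n⇒n≢0 (Fin.toℕ<n j)))
      index : ∀ {u} → u ∈ V → ∃[ j ] u ≡ c (l ℕ.+ toℕ j)
      index u∈V with ⊆ u∈V
      ... | j , l≤j , j<h , refl = fromℕ< lt ,
        cong c (sym (trans (cong (l ℕ.+_) (Fin.toℕ-fromℕ< lt)) (ℕ.m+[n∸m]≡n l≤j)))
        where lt = ℕ.∸-monoˡ-< j<h l≤j

    ∣range∣ : ∀ {V l h} → Enumerates V l h → ∣ V ∣ ≡ h ∸ l
    ∣range∣ {V} {l} {h} enum = ℤ.+-injective (trans (∣∣≡∑1 V) (trans (∑-range enum (const 1ℤ)) (sum-1 (h ∸ l))))

    U-range : Enumerates U 0 ℓ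
    U-range = record { bound = ℕ.≤-refl ; ⊇ = λ _ → c∈U ; ⊆ = λ u∈U → let j , j<ℓ , e = rung u∈U in j , z≤n , j<ℓ , e }

    -- Below `c k` the only element outside `U` can be `v`, and `v` is minimal, so it cannot lie
    -- above `c j`.
    between : ∀ {j k w} → j < ℓ → k < ℓ → c j ⊴ w → w ⊴ c k → ∃[ i ] j ≤ i × i ≤ k × w ≡ c i
    between {j} j<ℓ k<ℓ j⊴w w⊴k with below (c∈U k<ℓ) w⊴k
    ... | inj₂ v≡w = let w∉U , _ , min = bottom v≡w in
      contradiction (subst (_∈ U) (min j⊴w) (c∈U j<ℓ)) w∉U
    ... | inj₁ w∈U with rung w∈U
    ...   | i , i<ℓ , refl = i , reflect j<ℓ i<ℓ j⊴w , reflect i<ℓ k<ℓ w⊴k , refl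

    []-range : ∀ {j k} → j < ℓ → k < ℓ → Enumerates [ c j , c k ] j (suc k)
    []-range j<ℓ k<ℓ = record
      { bound = k<ℓ
      ; ⊇ = λ j≤i i<1+k → ∈[]⁺ (mono j≤i (ℕ.<-≤-trans i<1+k k<ℓ)) (mono (s≤s⁻¹ i<1+k) k<ℓ)
      ; ⊆ = λ w∈ → let j⊴w , w⊴k = ∈[]⁻ w∈ ; i , j≤i , i≤k , e = between j<ℓ k<ℓ j⊴w w⊴k in
          i , j≤i , s≤s i≤k , e
      }

    ⦅]-range : ∀ {j k} → j < ℓ → k < ℓ → Enumerates ⦅ c j , c k ] (suc j) (suc k)
    ⦅]-range {j} {k} j<ℓ k<ℓ = record
      { bound = k<ℓ
      ; ⊇ = λ j<i i<1+k → let i<ℓ = ℕ.<-≤-trans i<1+k k<ℓ in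
          ∈⦅]⁺ (mono (ℕ.<⇒≤ j<i) i<ℓ , (λ eq → ℕ.<⇒≢ j<i (c-injective j<ℓ i<ℓ eq))) (mono (s≤s⁻¹ i<1+k) k<ℓ)
      ; ⊆ = ⊆
      }
      where
      ⊆ : ∀ {w} → w ∈ ⦅ c j , c k ] → ∃[ i ] suc j ≤ i × i < suc k × w ≡ c i
      ⊆ w∈ with ∈⦅]⁻ w∈
      ... | (j⊴w , j≢w) , w⊴k with between j<ℓ k<ℓ j⊴w w⊴k
      ...   | i , j≤i , i≤k , refl = i , ℕ.≤∧≢⇒< j≤i (λ { refl → j≢w refl }) , s≤s i≤k , refl

    -- The elements of `U` up to `c j` are `c 0` to `c j`: ranks count from 1 while rungs count from
    -- 0.
    rank : ∀ {j} → j < ℓ → ∣ U ∩ ⟦ _⊴? c j ⟧ ∣ ≡ suc j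
    rank {j} j<ℓ = ∣range∣ {l = 0} record
      { bound = j<ℓ
      ; ⊇ = λ _ i<1+j → x∈p∩q⁺ (c∈U (ℕ.<-≤-trans i<1+j j<ℓ) , ∈⟦⟧⁺ (_⊴? c j) (mono (s≤s⁻¹ i<1+j) j<ℓ))
      ; ⊆ = λ w∈ → let w∈U , w∈↓ = x∈p∩q⁻ U _ w∈ ; i , i<ℓ , w≡ = rung w∈U in
          i , z≤n , s≤s (reflect i<ℓ j<ℓ (subst (_⊴ c j) w≡ (∈⟦⟧⁻ (_⊴? c j) w∈↓))) , w≡
      }

    nth-smallest : ∀ {k q} → NthSmallest (suc k) U q → k < ℓ × q ≡ c k
    nth-smallest (q∈U , r) with rung q∈U
    ... | j , j<ℓ , refl with refl ← ℕ.suc-injective (trans (sym r) (rank j<ℓ)) = j<ℓ , refl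

    module _ (J : 𝒥) where

      -- Shifted by one against c: index 0 is v, and index suc j is c j, or p for j = ℓ.
      E : ℕ → ℤ
      E zero    = maybe′ (e J) 1ℤ v
      E (suc j) = if does (j ℕ.<? ℓ) then e J (c j) else maybe′ (e J) 0ℤ p

      E-rung : ∀ {j} → j < ℓ → E (suc j) ≡ e J (c j)
      E-rung {j} j<ℓ = cong (if_then e J (c j) else maybe′ (e J) 0ℤ p) (dec-true (j ℕ.<? ℓ) j<ℓ)

      E-top : E (suc ℓ) ≡ maybe′ (e J) 0ℤ p
      E-top = cong (if_then e J (c ℓ) else maybe′ (e J) 0ℤ p) (dec-false (ℓ ℕ.<? ℓ) (ℕ.<-irrefl refl))

      -- The lower cover of a rung is the previous rung, and that of `c 0` is `v`. Without `v`,
      -- `c 0` is minimal and the default `1ℤ` in `E 0` gives the same formula.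
      A-c : ∀ j → j < ℓ → A (c j) J ≡ E j - E (suc j)
      A-c zero 0<ℓ = trans (first v refl) (cong (λ k → E 0 - k) (sym (E-rung 0<ℓ)))
        where
        first : ∀ v′ → v ≡ v′ → A (c 0) J ≡ maybe′ (e J) 1ℤ v′ - e J (c 0)
        first (just w) v≡w = A-cover J (w⊴U (c∈U 0<ℓ) , λ { refl → w∉U (c∈U 0<ℓ) }) lower
          where
          w∉U = proj₁ (bottom v≡w)
          w⊴U = proj₁ (proj₂ (bottom v≡w))
          lower : ∀ {s} → s ◁ c 0 → s ⊴ w
          lower (s⊴c , s≢c) with below (c∈U 0<ℓ) s⊴c
          ... | inj₂ v≡s = subst (_⊴ w) (just-injective (trans (sym v≡w) v≡s)) ⊴-refl
          ... | inj₁ s∈U with rung s∈U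
          ...   | k , k<ℓ , refl = contradiction (cong c (ℕ.n≤0⇒n≡0 (reflect k<ℓ 0<ℓ s⊴c))) s≢c
        first nothing v≡ = A-minimal J min
          where
          min : ∀ {s} → s ⊴ c 0 → s ≡ c 0
          min s⊴c with below (c∈U 0<ℓ) s⊴c
          ... | inj₂ v≡s with () ← trans (sym v≡) v≡s
          ... | inj₁ s∈U with rung s∈U
          ...   | k , k<ℓ , refl = cong c (ℕ.n≤0⇒n≡0 (reflect k<ℓ 0<ℓ s⊴c))
      A-c (suc j) 1+j<ℓ = trans
        (A-cover J (mono (ℕ.n≤1+n j) 1+j<ℓ , λ eq → ℕ.1+n≢n (sym (c-injective j<ℓ 1+j<ℓ eq))) lower)
        (sym (cong₂ _-_ (E-rung j<ℓ) (E-rung 1+j<ℓ)))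
        where
        j<ℓ = ℕ.<-trans ℕ.≤-refl 1+j<ℓ
        lower : ∀ {s} → s ◁ c (suc j) → s ⊴ c j
        lower (s⊴c , s≢c) with below (c∈U 1+j<ℓ) s⊴c
        ... | inj₂ v≡s = proj₁ (proj₂ (bottom v≡s)) (c∈U j<ℓ)
        ... | inj₁ s∈U with rung s∈U
        ...   | k , k<ℓ , refl =
          mono (s≤s⁻¹ (ℕ.≤∧≢⇒< (reflect k<ℓ 1+j<ℓ s⊴c) (λ k≡ → s≢c (cong c k≡)))) j<ℓ

      -- The upper cover of a rung is the next rung, and that of the last rung is `p`. Without `p`,
      -- the last rung is maximal and the default `0ℤ` fits.
      χ-c : ∀ j → j < ℓ → χ (c j) J ≡ E (suc j) - E (suc (suc j))
      χ-c j j<ℓ with ℕ.m≤n⇒m<n∨m≡n j<ℓ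
      ... | inj₁ 1+j<ℓ = trans
        (χ-cover J (mono (ℕ.n≤1+n j) 1+j<ℓ , λ eq → ℕ.1+n≢n (sym (c-injective j<ℓ 1+j<ℓ eq))) upper)
        (sym (cong₂ _-_ (E-rung j<ℓ) (E-rung 1+j<ℓ)))
        where
        upper : ∀ {s} → c j ◁ s → c (suc j) ⊴ s
        upper (c⊴s , c≢s) with above (c∈U j<ℓ) c⊴s
        ... | inj₂ p≡s = proj₁ (proj₂ (top p≡s)) (c∈U 1+j<ℓ)
        ... | inj₁ s∈U with rung s∈U
        ...   | k , k<ℓ , refl = mono (ℕ.≤∧≢⇒< (reflect j<ℓ k<ℓ c⊴s) (λ k≡ → c≢s (cong c k≡))) k<ℓ
      ... | inj₂ refl = trans (last p refl) (sym (cong₂ _-_ (E-rung j<ℓ) E-top))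
        where
        topmost : ∀ {s} → s ∈ U → c j ⊴ s → s ≡ c j
        topmost s∈U c⊴s with rung s∈U
        ... | k , k<ℓ , refl = cong c (ℕ.≤-antisym (s≤s⁻¹ k<ℓ) (reflect j<ℓ k<ℓ c⊴s))
        last : ∀ p′ → p ≡ p′ → χ (c j) J ≡ e J (c j) - maybe′ (e J) 0ℤ p′
        last (just w) p≡w = χ-cover J (U⊴w (c∈U j<ℓ) , λ { refl → w∉U (c∈U j<ℓ) }) upper
          where
          w∉U = proj₁ (top p≡w)
          U⊴w = proj₁ (proj₂ (top p≡w))
          upper : ∀ {s} → c j ◁ s → w ⊴ s
          upper (c⊴s , c≢s) with above (c∈U j<ℓ) c⊴s
          ... | inj₂ p≡s = subst (w ⊴_) (just-injective (trans (sym p≡w) p≡s)) ⊴-refl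
          ... | inj₁ s∈U = contradiction (sym (topmost s∈U c⊴s)) c≢s
        last nothing p≡ = trans (χ-maximal J max) (sym (ℤ.+-identityʳ _))
          where
          max : ∀ {s} → c j ⊴ s → s ≡ c j
          max c⊴s with above (c∈U j<ℓ) c⊴s
          ... | inj₂ p≡s with () ← trans (sym p≡) p≡s
          ... | inj₁ s∈U = topmost s∈U c⊴s

      T-c : ∀ {j} → j < ℓ → T (c j) J ≡ Δ² E j
      T-c {j} j<ℓ = trans (T≡A-χ (c j) J) (cong₂ _-_ (A-c j j<ℓ) (χ-c j j<ℓ))

      χ′-p : χ′ p J ≡ E (suc ℓ)
      χ′-p = trans (go p refl) (sym E-top)
        where
        go : ∀ p′ → p ≡ p′ → χ′ p′ J ≡ maybe′ (e J) 0ℤ p′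
        go (just w) p≡w = χ-maximal J (proj₂ (proj₂ (top p≡w)))
        go nothing  _   = refl

      -- `v` is minimal, so its addability is `1ℤ - E 0`. `χ′ v J` is left as it stands, since `v`
      -- may have covers outside `U`; it cancels in the final identity. For a missing `v` both sides
      -- are zero.
      T′-v : T′ v J ≡ 1ℤ - E 0 - χ′ v J
      T′-v = go v refl
        where
        go : ∀ v′ → v ≡ v′ → T′ v′ J ≡ 1ℤ - maybe′ (e J) 1ℤ v′ - χ′ v′ J
        go (just w) v≡w = trans (T≡A-χ w J) (cong (_- χ w J) (A-minimal J (proj₂ (proj₂ (bottom v≡w)))))
        go nothing  _   = refl

      -- The interval from `c 0` to `c j` has `1 + j` elements, a weight of slope `1ℤ`. The closed
      -- form stays unsimplified for the ring solver.
      lower-sum : ∀ {m} → m < ℓ →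
        (∑[ u ∈ [ c 0 , c m ] ] (+ ∣ [ c 0 , u ] ∣ * T u J))
          ≡ 1ℤ * E 0 - (1ℤ - 1ℤ) * E 1 - (1ℤ + 1ℤ * (1ℤ + + m)) * E (suc m)
            + (1ℤ + 1ℤ * (1ℤ + + m) - 1ℤ) * E (suc (suc m))
      lower-sum {m} m<ℓ = trans (∑-range ([]-range 0<ℓ m<ℓ) _)
        (trans (sum-cong-≗ {suc m} term) (∑-affine-Δ² (suc m) 1ℤ 1ℤ E))
        where
        0<ℓ = ℕ.≤-<-trans z≤n m<ℓ
        term : ∀ (j : Fin (suc m)) → + ∣ [ c 0 , c (toℕ j) ] ∣ * T (c (toℕ j)) J
                                       ≡ (1ℤ + 1ℤ * + toℕ j) * Δ² E (toℕ j)
        term j = cong₂ _*_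
          (trans (cong +_ (∣range∣ ([]-range 0<ℓ j<ℓ))) (cong (λ k → 1ℤ + k) (sym (ℤ.*-identityˡ (+ toℕ j)))))
          (T-c j<ℓ)
          where j<ℓ = ℕ.<-≤-trans (Fin.toℕ<n j) m<ℓ

      -- With `c k` the last rung, the interval from `c (suc m + j)` to it has `d - j` elements, a
      -- weight of slope `-1ℤ`. The weight vanishes at `j = d`, so at the far end only `E (suc ℓ)`
      -- remains, with coefficient one.
      upper-sum : ∀ {m k} → m ≤ k → suc k ≡ ℓ → let d = k ∸ m in
        (∑[ u ∈ ⦅ c m , c k ] ] (+ ∣ [ u , c k ] ∣ * T u J))
          ≡ + d * E (suc m) - (+ d - -1ℤ) * E (suc (suc m)) - (+ d + -1ℤ * + d) * E (suc m ℕ.+ d)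
            + (+ d + -1ℤ * + d - -1ℤ) * E (suc ℓ)
      upper-sum {m} {k} m≤k refl = begin
        (∑[ u ∈ ⦅ c m , c k ] ] (+ ∣ [ u , c k ] ∣ * T u J))
          ≡⟨ ∑-range (⦅]-range (s≤s m≤k) ℕ.≤-refl) _ ⟩
        sum {d} (λ j → + ∣ [ c (suc m ℕ.+ toℕ j) , c k ] ∣ * T (c (suc m ℕ.+ toℕ j)) J)
          ≡⟨ sum-cong-≗ term ⟩
        sum {d} (λ j → (+ d + -1ℤ * + toℕ j) * Δ² E′ (toℕ j))
          ≡⟨ ∑-affine-Δ² d (+ d) -1ℤ E′ ⟩
        + d * E′ 0 - (+ d - -1ℤ) * E′ 1 - (+ d + -1ℤ * + d) * E′ d + (+ d + -1ℤ * + d - -1ℤ) * E′ (suc d)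
          ≡⟨ cong₂ (λ a b → + d * a - (+ d - -1ℤ) * b - (+ d + -1ℤ * + d) * E′ d + (+ d + -1ℤ * + d - -1ℤ) * E′ (suc d))
               (cong E (ℕ.+-identityʳ (suc m))) (cong E (ℕ.+-comm (suc m) 1)) ⟩
        + d * E (suc m) - (+ d - -1ℤ) * E (suc (suc m)) - (+ d + -1ℤ * + d) * E′ d + (+ d + -1ℤ * + d - -1ℤ) * E′ (suc d)
          ≡⟨ cong (λ i → + d * E (suc m) - (+ d - -1ℤ) * E (suc (suc m)) - (+ d + -1ℤ * + d) * E′ d + (+ d + -1ℤ * + d - -1ℤ) * E i)
               (trans (ℕ.+-suc (suc m) d) (cong (λ i → suc (suc i)) (ℕ.m+[n∸m]≡n m≤k))) ⟩
        + d * E (suc m) - (+ d - -1ℤ) * E (suc (suc m)) - (+ d + -1ℤ * + d) * E′ d + (+ d + -1ℤ * + d - -1ℤ) * E (suc (suc k)) ∎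
        where
        open ≡-Reasoning
        d = k ∸ m
        E′ = λ i → E (suc m ℕ.+ i)
        term : ∀ (j : Fin d) → + ∣ [ c (suc m ℕ.+ toℕ j) , c k ] ∣ * T (c (suc m ℕ.+ toℕ j)) J
                                 ≡ (+ d + -1ℤ * + toℕ j) * Δ² E′ (toℕ j)
        term j = cong₂ _*_
          (trans (cong +_ (trans (∣range∣ ([]-range i<ℓ ℕ.≤-refl)) (sym (ℕ.∸-+-assoc k m (toℕ j)))))
                 (pos-∸ (ℕ.<⇒≤ (Fin.toℕ<n j))))
          (trans (T-c i<ℓ) (sym (Δ²-shift E (suc m) (toℕ j))))
          where
          i<ℓ : suc m ℕ.+ toℕ j < suc k
          i<ℓ = s≤s (ℕ.≤-trans (ℕ.+-monoʳ-< m (Fin.toℕ<n j)) (ℕ.≤-reflexive (ℕ.m+[n∸m]≡n m≤k)))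

      -- For `x = c m`, with `d` rungs above it, `suc ℓ = m + d + 2`. The two sums together give
      -- `E (suc m)` and `E (suc (suc m))` the coefficients plus and minus `m + d + 2`; `E 0`
      -- cancels against `T′ v J`, and `E (suc ℓ)` is `χ′ p J`.
      ladder-toggle : ∀ {x y z} → x ∈ U → NthSmallest 1 U y → NthSmallest ∣ U ∣ U z →
        + suc ℓ * χ x J + χ′ v J + χ′ p J
          ≡ 1ℤ - T′ v J
            - (∑[ u ∈ [ y , x ] ] (+ ∣ [ y , u ] ∣ * T u J))
            + (∑[ u ∈ ⦅ x , z ] ] (+ ∣ [ u , z ] ∣ * T u J))
      ladder-toggle {z = z} x∈U y-first z-last with rung x∈U | nth-smallest y-first
      -- `nth-smallest` expects a rank of the form `suc k`; the rung `c m` shows that `ℓ` is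
      -- positive.
      ... | m , m<ℓ , refl | _ , refl with nth-smallest (subst (λ k → NthSmallest k U z) ∣U∣≡ z-last)
        where
        ∣U∣≡ : ∣ U ∣ ≡ suc (ℕ.pred ℓ)
        ∣U∣≡ = trans (∣range∣ U-range) (sym (ℕ.suc-pred ℓ {{ℕ.>-nonZero (ℕ.≤-<-trans z≤n m<ℓ)}}))
      ...   | _ , refl = begin
        + suc ℓ * χ (c m) J + χ′ v J + χ′ p J
          ≡⟨ cong₂ (λ a b → a + χ′ v J + b)
               (cong₂ _*_ (cong (λ i → + suc i) ℓ≡) (χ-c m m<ℓ)) χ′-p ⟩
        (1ℤ + (1ℤ + (+ m + + d))) * (E (suc m) - E (suc (suc m))) + χ′ v J + E (suc ℓ)
          ≡⟨ combine (+ m) (+ d) (E 0) (E 1) (E (suc m)) (E (suc (suc m))) (E (suc m ℕ.+ d)) (E (suc ℓ)) (χ′ v J) ⟩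
        _ ≡⟨ cong₂ _+_ (cong₂ (λ a b → 1ℤ - a - b) T′-v (lower-sum m<ℓ)) (upper-sum m≤k 1+k≡ℓ) ⟨
        _ ∎
        where
        open ≡-Reasoning
        k = ℕ.pred ℓ
        d = k ∸ m
        1+k≡ℓ : suc k ≡ ℓ
        1+k≡ℓ = ℕ.suc-pred ℓ {{ℕ.>-nonZero (ℕ.≤-<-trans z≤n m<ℓ)}}
        m≤k : m ≤ k
        m≤k = s≤s⁻¹ (subst (m <_) (sym 1+k≡ℓ) m<ℓ)
        ℓ≡ : ℓ ≡ suc (m ℕ.+ d)
        ℓ≡ = trans (sym 1+k≡ℓ) (cong suc (sym (ℕ.m+[n∸m]≡n m≤k)))
        combine : ∀ m d e₀ e₁ a b q t w →
          (1ℤ + (1ℤ + (m + d))) * (a - b) + w + t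
            ≡ 1ℤ - (1ℤ - e₀ - w)
              - (1ℤ * e₀ - (1ℤ - 1ℤ) * e₁ - (1ℤ + 1ℤ * (1ℤ + m)) * a + (1ℤ + 1ℤ * (1ℤ + m) - 1ℤ) * b)
              + (d * a - (d - -1ℤ) * b - (d + -1ℤ * d) * q + (d + -1ℤ * d - -1ℤ) * t)
        combine = solve-∀

-- Auxiliary facts on unique choice, subsets, prefix sums and parity.

the-sound : ∀ {n} {P : Pred (Fin n) 0ℓ} (P? : Decidable P) {q} → the P? ≡ just q → P q
the-sound P? eq with Fin.any? P?
the-sound P? refl | yes (_ , Pq) = Pq

the-complete : ∀ {n} {P : Pred (Fin n) 0ℓ} (P? : Decidable P) {q} →
               P q → (∀ {r} → P r → r ≡ q) → the P? ≡ just q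
the-complete P? Pq unique with Fin.any? P?
... | yes (_ , Pr) = cong just (unique Pr)
... | no ¬∃        = contradiction (_ , Pq) ¬∃

x∈p─q⇒x∉q : ∀ {n} (p q : Subset n) {x} → x ∈ p ─ q → x ∉ q
x∈p─q⇒x∉q (_ ∷ p) (_ ∷ q)    (Vec.there x∈) (Vec.there x∈q) = x∈p─q⇒x∉q p q x∈ x∈q
x∈p─q⇒x∉q (_ ∷ p) (true ∷ q) ()             Vec.here

sum-take-suc : ∀ {k} (xs : Vec ℕ k) (i : Fin k) →
               ListAction.sum (take (suc (toℕ i)) (toList xs)) ≡ ListAction.sum (take (toℕ i) (toList xs)) ℕ.+ lookup xs i
sum-take-suc (x ∷ xs) zero    = ℕ.+-identityʳ x
sum-take-suc (x ∷ xs) (suc i) = trans (cong (x ℕ.+_) (sum-take-suc xs i)) (sym (ℕ.+-assoc x _ _))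

sum-take-last : ∀ {k} (xs : Vec ℕ (suc k)) →
                ListAction.sum (take (suc k) (toList xs)) ≡ ListAction.sum (take k (toList xs)) ℕ.+ Vec.last xs
sum-take-last {zero}  (x ∷ [])     = ℕ.+-identityʳ x
sum-take-last {suc k} (x ∷ y ∷ xs) = trans (cong (x ℕ.+_) (sum-take-last (y ∷ xs))) (sym (ℕ.+-assoc x _ _))

⁻¹-irrefl : ∀ π → π ≢ π ⁻¹
⁻¹-irrefl 0ℙ ()
⁻¹-irrefl 1ℙ ()

parity-suc : ∀ k → parity (suc k) ≡ parity k ⁻¹
parity-suc k = sym (suc-homo-⁻¹ (suc k))

parity-suc-≢ : ∀ k → parity (suc k) ≢ parity k
parity-suc-≢ k e = ⁻¹-irrefl (parity k) (trans (sym e) (parity-suc k))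

-- Positions and blocks of a fence.

module FenceSegments {m : ℕ} (α : Vec ℕ (2 ℕ.+ m)) (shape : IsFenceShape α) where

  open Fence α
  open IsFenceShape shape

  a-suc : ∀ (i : Fin t) → a (suc (toℕ i)) ≡ a (toℕ i) ℕ.+ lookup α i
  a-suc = sum-take-suc α

  a<a-suc : ∀ {k} → k < t → a k < a (suc k)
  a<a-suc {k} k<t = subst (λ j → a j < a (suc j)) (Fin.toℕ-fromℕ< k<t)
    (ℕ.<-≤-trans (ℕ.m<m+n _ (positive (fromℕ< k<t))) (ℕ.≤-reflexive (sym (a-suc (fromℕ< k<t)))))

  a-strict : ∀ {k l} → k < l → l ≤ t → a k < a l
  a-strict k<l l≤t = ℕ.<-≤-trans (a<a-suc (ℕ.<-≤-trans k<l l≤t)) (a-mono k<l)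

  a-reflect : ∀ {k l} → k ≤ t → a k ≤ a l → k ≤ l
  a-reflect {k} {l} k≤t ak≤al with k ℕ.≤? l
  ... | yes k≤l = k≤l
  ... | no k≰l  = contradiction ak≤al (ℕ.<⇒≱ (a-strict (ℕ.≰⇒> k≰l) k≤t))

  2≤a : ∀ k → 2 ≤ a (suc k)
  2≤a k = ℕ.≤-trans (first α first≥2) (a-mono {1} {suc k} (s≤s z≤n))
    where
    first : ∀ {k} (xs : Vec ℕ (suc k)) → 2 ≤ Vec.head xs → 2 ≤ ListAction.sum (take 1 (toList xs))
    first (x ∷ _) 2≤x = ℕ.≤-trans 2≤x (ℕ.m≤m+n x 0)

  -- The last part is at least 2, so every shared element has a right neighbour inside the fence.
  2+a≤ : ∀ {k} → k < t → 2 ℕ.+ a k ≤ a t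
  2+a≤ k<t = ℕ.≤-trans (ℕ.+-monoʳ-≤ 2 (a-mono (s≤s⁻¹ k<t)))
    (ℕ.≤-trans (ℕ.+-monoˡ-≤ (a (suc m)) last≥2)
      (ℕ.≤-reflexive (trans (ℕ.+-comm (Vec.last α) _) (sym (sum-take-last α)))))

  suc-n : suc n ≡ a t
  suc-n = ℕ.m+[n∸m]≡n (ℕ.≤-trans (s≤s z≤n) (2≤a (suc m)))

  pos<a : ∀ q → pos q < a t
  pos<a q = subst (pos q <_) suc-n (s≤s (Fin.toℕ<n q))

  block : ∀ {k j} → k < t → a k ≤ j → j < a (suc k) → Block (parity (suc k)) j
  block {k} k<t l u with fromℕ< k<t | Fin.toℕ-fromℕ< k<t
  ... | i | refl = i , refl , l , u

  block-unique : ∀ {π ρ j} → Block π j → Block ρ j → π ≡ ρ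
  block-unique {0ℙ} {0ℙ} _ _ = refl
  block-unique {0ℙ} {1ℙ} b b′ = contradiction b (blocks-disjoint b′)
  block-unique {1ℙ} {0ℙ} b b′ = contradiction b′ (blocks-disjoint b)
  block-unique {1ℙ} {1ℙ} _ _ = refl

  -- The position just before `a k` belongs to the preceding block, so the slope changes at `a k`.
  block-pred : ∀ k → k < t → 0 < a k → Block (parity (suc k) ⁻¹) (ℕ.pred (a k))
  block-pred (suc k) k<t 0<a = subst (λ ρ → Block ρ (ℕ.pred (a (suc k)))) (sym (suc-homo-⁻¹ (suc k)))
    (block (ℕ.<⇒≤ k<t) (ℕ.<⇒≤pred (a<a-suc (ℕ.<⇒≤ k<t))) (ℕ.≤-reflexive (ℕ.suc-pred _ {{ℕ.>-nonZero 0<a}})))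

  -- The order, read from left to right along segments of parity 1ℙ and from right to left along the others.
  Ord : Parity → Rel (Fin n) 0ℓ
  Ord 1ℙ = _⊴_
  Ord 0ℙ = flip _⊴_

  Ord-flip : ∀ π {q r} → Ord π q r → Ord (π ⁻¹) r q
  Ord-flip 0ℙ o = o
  Ord-flip 1ℙ o = o

  Span⇒Ord : ∀ π {q r} → Span π q r → Ord π q r
  Span⇒Ord 0ℙ s = Run⇒⊴ (inj₂ s)
  Span⇒Ord 1ℙ s = Run⇒⊴ (inj₁ s)

  Ord⇒Span : ∀ π {q r} → Ord π q r → Span π q r ⊎ Span (π ⁻¹) r q
  Ord⇒Span 0ℙ o = swap (⊴⇒Run o)
  Ord⇒Span 1ℙ o = ⊴⇒Run o

  span-block : ∀ {π q r j} → Span π q r → pos q ≤ j → j ≤ toℕ r → Block π j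
  span-block {j = suc k} (_ , f) q≤j j≤r = f j≤r (s≤s⁻¹ q≤j)

  -- Valleys and peaks through the parities of adjacent blocks.

  -- In both cases these are shared elements minimal for Ord π.
  Low : Parity → Pred (Fin n) 0ℓ
  Low 1ℙ = IsValley
  Low 0ℙ = IsPeak

  -- For a segment of parity `π`, `ext π` turns out to be its left end and `ext (π ⁻¹)` its right
  -- end.
  ext : Parity → Fin t → Maybe (Fin n)
  ext 1ℙ = valley
  ext 0ℙ = peak

  -- These are the covers of `Ord π`, sorted by right and left neighbour so that one argument serves
  -- valleys and peaks.
  Step : Parity → Rel (Fin n) 0ℓ
  Step π q w = (Block π (pos q) × pos w ≡ suc (pos q)) ⊎ (Block (π ⁻¹) (pos w) × pos q ≡ suc (pos w))

  Low⇒Steps : ∀ π {q} → Low π q → ∃[ w ] ∃[ w′ ] w ≢ w′ × Step π q w × Step π q w′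
  Low⇒Steps 1ℙ {q} (w , w′ , w≢w′ , s , s′) = w , w′ , w≢w′ , step s , step s′
    where
    step : ∀ {w} → q ⋖ w → Step 1ℙ q w
    step (up b e)   = inj₁ (b , e)
    step (down b e) = inj₂ (b , e)
  Low⇒Steps 0ℙ {q} (w , w′ , w≢w′ , s , s′) = w , w′ , w≢w′ , step s , step s′
    where
    step : ∀ {w} → w ⋖ q → Step 0ℙ q w
    step (up b e)   = inj₂ (b , e)
    step (down b e) = inj₁ (b , e)

  -- Two distinct covers cannot both be right neighbours or both left neighbours, so there is one on
  -- each side. The left neighbour has position `toℕ q`.
  Low⇒Blocks : ∀ π {q} → Low π q → Block π (pos q) × Block (π ⁻¹) (toℕ q)
  Low⇒Blocks π {q} low with Low⇒Steps π low
  ... | w , w′ , w≢w′ , inj₁ (_ , e) , inj₁ (_ , e′) =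
    contradiction (Fin.toℕ-injective (ℕ.suc-injective (trans e (sym e′)))) w≢w′
  ... | w , w′ , w≢w′ , inj₂ (_ , e) , inj₂ (_ , e′) =
    contradiction (Fin.toℕ-injective (ℕ.suc-injective (ℕ.suc-injective (trans (sym e) e′)))) w≢w′
  ... | _ , _ , _ , inj₁ (b , _) , inj₂ (b′ , e′) = b , subst (Block (π ⁻¹)) (sym (ℕ.suc-injective e′)) b′
  ... | _ , _ , _ , inj₂ (b′ , e′) , inj₁ (b , _) = b , subst (Block (π ⁻¹)) (sym (ℕ.suc-injective e′)) b′

  Blocks⇒Low : ∀ π {q} → 1 ≤ toℕ q → pos q < n → Block π (pos q) → Block (π ⁻¹) (toℕ q) → Low π q
  Blocks⇒Low π {q} 1≤q q<n b b′ = low π b (subst (Block (π ⁻¹)) left≡ b′)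
    where
    right = fromℕ< q<n
    right≡ : pos right ≡ suc (pos q)
    right≡ = cong suc (Fin.toℕ-fromℕ< q<n)
    left<n : ℕ.pred (toℕ q) < n
    left<n = ℕ.≤-<-trans ℕ.pred[n]≤n (Fin.toℕ<n q)
    left = fromℕ< left<n
    left≡ : toℕ q ≡ pos left
    left≡ = trans (sym (ℕ.suc-pred (toℕ q) {{ℕ.>-nonZero 1≤q}})) (cong suc (sym (Fin.toℕ-fromℕ< left<n)))
    right≢left : right ≢ left
    right≢left e = ℕ.<⇒≢ (ℕ.m<n+m (pos left) {2} z<s)
      (trans (sym (cong pos e)) (trans right≡ (cong (λ k → suc (suc k)) left≡)))
    low : ∀ π → Block π (pos q) → Block (π ⁻¹) (pos left) → Low π q
    low 1ℙ b b′ = right , left , right≢left , up b right≡ , down b′ (cong suc left≡)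
    low 0ℙ b b′ = right , left , right≢left , down b right≡ , up b′ (cong suc left≡)

  -- A nontrivial run down from `q` would begin with the step on one side of `q`, whose block has
  -- the wrong parity for it.
  Low⇒minimal : ∀ π {q r} → Low π q → Ord π r q → r ≡ q
  Low⇒minimal π {q} {r} low r≼q with Low⇒Blocks π low | Ord⇒Span π r≼q
  ... | _ , b | inj₁ s@(r≤q , _) with ℕ.m≤n⇒m<n∨m≡n r≤q
  ...   | inj₁ r<q = contradiction (block-unique (span-block s r<q ℕ.≤-refl) b) (⁻¹-irrefl π)
  ...   | inj₂ r≡q = Fin.toℕ-injective r≡q
  Low⇒minimal π {q} {r} low r≼q | b , _ | inj₂ s@(q≤r , _) with ℕ.m≤n⇒m<n∨m≡n q≤r
  ...   | inj₁ q<r = contradiction (block-unique b (span-block s ℕ.≤-refl q<r)) (⁻¹-irrefl π)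
  ...   | inj₂ q≡r = Fin.toℕ-injective (sym q≡r)

  Low-shared⁺ : ∀ {k q} → suc k < t → pos q ≡ a (suc k) → Low (parity (suc (suc k))) q
  Low-shared⁺ {k} {q} k<t e = Blocks⇒Low _
    (s≤s⁻¹ (ℕ.≤-trans (2≤a k) (ℕ.≤-reflexive (sym e))))
    (s≤s⁻¹ (subst (_≤ suc n) (cong (λ k → suc (suc k)) (sym e)) (ℕ.≤-trans (2+a≤ k<t) (ℕ.≤-reflexive (sym suc-n)))))
    (block k<t (ℕ.≤-reflexive (sym e)) (ℕ.≤-<-trans (ℕ.≤-reflexive e) (a<a-suc k<t)))
    (subst (Block _) (cong ℕ.pred (sym e)) (block-pred (suc k) k<t (ℕ.<⇒≤ (2≤a k))))

  shared⁻ : ∀ {q} → q ∈ shared → ∃[ k ] suc k < t × pos q ≡ a (suc k)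
  shared⁻ q∈ = let k , e = ∈⟦⟧⁻ (λ q → Fin.any? {n = suc m} λ k → pos q ℕ.≟ a (suc (toℕ k))) q∈ in toℕ k , s≤s (Fin.toℕ<n k) , e

  shared⁺ : ∀ {q k} → k ≤ t → pos q ≡ a k → q ∈ shared
  shared⁺ {q} {suc k} k≤t e with ℕ.m≤n⇒m<n∨m≡n k≤t
  ... | inj₁ k<t = ∈⟦⟧⁺ (λ q → Fin.any? {n = suc m} λ k → pos q ℕ.≟ a (suc (toℕ k)))
    (fromℕ< (s≤s⁻¹ k<t) , trans e (cong (a ∘ suc) (sym (Fin.toℕ-fromℕ< (s≤s⁻¹ k<t)))))
  ... | inj₂ refl = contradiction e (ℕ.<⇒≢ (pos<a q))

  -- The inequalities leave `suc k` equal to `toℕ i` (left end) or to `suc (toℕ i)` (right end), and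
  -- `parity k` is the parity of the block starting at `q`.
  record IsEnd (ρ : Parity) (i : Fin t) (q : Fin n) : Set where
    constructor isEnd
    field
      {k}    : ℕ
      k<t    : suc k < t
      i≤k    : toℕ i ≤ suc k
      k≤1+i  : k ≤ toℕ i
      pos≡   : pos q ≡ a (suc k)
      parity≡ : ρ ≡ parity k

  -- The two ends of a segment have consecutive indices, hence opposite parities, so `ρ` selects one
  -- of them.
  isEnd-unique : ∀ {ρ i q r} → IsEnd ρ i q → IsEnd ρ i r → r ≡ q
  isEnd-unique {i = i} (isEnd {k} _ i≤k k≤i e p) (isEnd {l} _ i≤l l≤i e′ p′) =
    Fin.toℕ-injective (ℕ.suc-injective (trans e′ (trans (cong (λ j → a (suc j)) l≡k) (sym e))))
    where
    l≡k : l ≡ k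
    l≡k with ℕ.m≤n⇒m<n∨m≡n k≤i | ℕ.m≤n⇒m<n∨m≡n l≤i
    ... | inj₂ refl | inj₂ refl = refl
    ... | inj₁ k<i  | inj₁ l<i  = ℕ.suc-injective (trans (ℕ.≤-antisym l<i i≤l) (ℕ.≤-antisym i≤k k<i))
    ... | inj₂ refl | inj₁ l<i  =
      contradiction (trans (cong parity (ℕ.≤-antisym l<i i≤l)) (trans (sym p) p′)) (parity-suc-≢ l)
    ... | inj₁ k<i  | inj₂ refl =
      contradiction (trans (cong parity (ℕ.≤-antisym k<i i≤k)) (trans (sym p′) p)) (parity-suc-≢ k)

  ∈S⁻ : ∀ {i q} → q ∈ S i → a (toℕ i) ≤ pos q × pos q ≤ a (suc (toℕ i))
  ∈S⁻ {i} = ∈⟦⟧⁻ (λ q → (a (toℕ i) ℕ.≤? pos q) ×-dec (pos q ℕ.≤? a (suc (toℕ i))))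

  ∈S⁺ : ∀ {i q} → a (toℕ i) ≤ pos q → pos q ≤ a (suc (toℕ i)) → q ∈ S i
  ∈S⁺ {i} l u = ∈⟦⟧⁺ (λ q → (a (toℕ i) ℕ.≤? pos q) ×-dec (pos q ℕ.≤? a (suc (toℕ i)))) (l , u)

  IsExt : Parity → Fin t → Pred (Fin n) 0ℓ
  IsExt ρ i q = q ∈ S i ∩ shared × Low ρ q

  ext-sound : ∀ ρ i {q} → ext ρ i ≡ just q → IsExt ρ i q
  ext-sound 1ℙ i = the-sound (λ q → (q ∈? S i ∩ shared) ×-dec isValley? q)
  ext-sound 0ℙ i = the-sound (λ q → (q ∈? S i ∩ shared) ×-dec isPeak? q)

  ext-complete : ∀ ρ i {q} → IsExt ρ i q → (∀ {r} → IsExt ρ i r → r ≡ q) → ext ρ i ≡ just q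
  ext-complete 1ℙ i = the-complete (λ q → (q ∈? S i ∩ shared) ×-dec isValley? q)
  ext-complete 0ℙ i = the-complete (λ q → (q ∈? S i ∩ shared) ×-dec isPeak? q)

  IsExt⇒IsEnd : ∀ {ρ i q} → IsExt ρ i q → IsEnd ρ i q
  IsExt⇒IsEnd {ρ} {i} (q∈ , low) with x∈p∩q⁻ (S i) shared q∈
  ... | q∈S , q∈shared with ∈S⁻ q∈S | shared⁻ q∈shared
  ...   | l , u | k , k<t , e = isEnd k<t
    (a-reflect (ℕ.<⇒≤ (Fin.toℕ<n i)) (subst (a (toℕ i) ≤_) e l))
    (s≤s⁻¹ (a-reflect (ℕ.<⇒≤ k<t) (subst (_≤ a (suc (toℕ i))) e u)))
    e
    -- Both parities are that of the block containing `pos q`.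
    (block-unique (proj₁ (Low⇒Blocks ρ low)) (proj₁ (Low⇒Blocks _ (Low-shared⁺ k<t e))))

  IsEnd⇒IsExt : ∀ {ρ i q} → IsEnd ρ i q → IsExt ρ i q
  IsEnd⇒IsExt {i = i} (isEnd k<t i≤k k≤i e refl) =
    x∈p∩q⁺ (∈S⁺ {i} (subst (a (toℕ i) ≤_) (sym e) (a-mono i≤k)) (subst (_≤ a (suc (toℕ i))) (sym e) (a-mono (s≤s k≤i)))
           , shared⁺ (ℕ.<⇒≤ k<t) e)
    , Low-shared⁺ k<t e

  IsEnd⇒ext : ∀ {ρ i q} → IsEnd ρ i q → ext ρ i ≡ just q
  IsEnd⇒ext {ρ} {i} end = ext-complete ρ i (IsEnd⇒IsExt end) (λ ext → isEnd-unique end (IsExt⇒IsEnd {ρ} ext))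

  -- A single segment as a ladder.

  module Segment (i : Fin t) where

    lo hi : ℕ
    lo = a (toℕ i)
    hi = a (suc (toℕ i))

    π : Parity
    π = parity (suc (toℕ i))

    i<t : toℕ i < t
    i<t = Fin.toℕ<n i

    Interior : Pred (Fin n) 0ℓ
    Interior u = lo < pos u × pos u < hi

    Interior⇒∈S̆ : ∀ {u} → Interior u → u ∈ S̆ i
    Interior⇒∈S̆ {u} (lo<u , u<hi) =
      x∈p∧x∉q⇒x∈p─q (∈S⁺ {i} (ℕ.<⇒≤ lo<u) (ℕ.<⇒≤ u<hi)) unshared
      where
      unshared : u ∉ shared
      unshared u∈ with shared⁻ u∈
      -- A shared position strictly inside the segment would give `toℕ i < suc k < suc (toℕ i)`.
      ... | k , k<t , e = ℕ.<⇒≱ i<k (s≤s⁻¹ k≤i)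
        where
        i<k : toℕ i < suc k
        i<k = ℕ.≰⇒> (λ k≤i → ℕ.<⇒≱ (subst (lo <_) e lo<u) (a-mono k≤i))
        k≤i : suc (suc k) ≤ suc (toℕ i)
        k≤i = ℕ.≰⇒> (λ i≤k → ℕ.<⇒≱ (subst (_< hi) e u<hi) (a-mono i≤k))

    ∈S̆⇒Interior : ∀ {u} → u ∈ S̆ i → Interior u
    ∈S̆⇒Interior u∈ with ∈S⁻ {i} (p─q⊆p (S i) shared u∈) | x∈p─q⇒x∉q (S i) shared u∈
    ... | l , u | unshared =
      ℕ.≤∧≢⇒< l (λ e → unshared (shared⁺ (ℕ.<⇒≤ i<t) (sym e))) ,
      ℕ.≤∧≢⇒< u (λ e → unshared (shared⁺ i<t e))

    Block-π : ∀ {j} → lo ≤ j → j < hi → Block π j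
    Block-π = block i<t

    ¬Block-π⁻¹ : ∀ {j} → lo ≤ j → j < hi → ¬ Block (π ⁻¹) j
    ¬Block-π⁻¹ l u b = ⁻¹-irrefl π (block-unique (Block-π l u) b)

    span⁺ : ∀ {q r} → lo ≤ pos q → toℕ q ≤ toℕ r → pos r ≤ hi → Span π q r
    span⁺ lo≤q q≤r r≤hi = q≤r , λ k<r q≤k → Block-π (ℕ.≤-trans lo≤q (s≤s q≤k)) (ℕ.≤-trans (s≤s k<r) r≤hi)

    -- Both steps at an interior element have parity `π`, so going down in `Ord π` means going left;
    -- the step just before `lo` has the opposite parity and stops the run.
    below⁻ : ∀ {u w} → Interior u → Ord π w u → lo ≤ pos w × toℕ w ≤ toℕ u
    below⁻ {u} {w} (lo<u , u<hi) w≼u with Ord⇒Span π w≼u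
    ... | inj₂ s@(u≤w , _) with ℕ.m≤n⇒m<n∨m≡n u≤w
    ...   | inj₁ u<w = contradiction (span-block s ℕ.≤-refl u<w) (¬Block-π⁻¹ (ℕ.<⇒≤ lo<u) u<hi)
    ...   | inj₂ u≡w = ℕ.≤-trans (ℕ.<⇒≤ lo<u) (s≤s u≤w) , ℕ.≤-reflexive (sym u≡w)
    below⁻ {u} {w} (lo<u , u<hi) w≼u | inj₁ s@(w≤u , _) = ℕ.≮⇒≥ absurd , w≤u
      where
      absurd : ¬ (pos w < lo)
      absurd w<lo = ⁻¹-irrefl π (block-unique
        (span-block s (ℕ.<⇒≤pred w<lo) (ℕ.≤-trans ℕ.pred[n]≤n (s≤s⁻¹ lo<u)))
        (block-pred (toℕ i) i<t (ℕ.≤-<-trans z≤n w<lo)))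

    above⁻ : ∀ {u w} → Interior u → Ord π u w → toℕ u ≤ toℕ w × pos w ≤ hi
    above⁻ {u} {w} (lo<u , u<hi) u≼w with Ord⇒Span π u≼w
    ... | inj₂ s@(w≤u , _) with ℕ.m≤n⇒m<n∨m≡n w≤u
    ...   | inj₁ w<u = contradiction (span-block s w<u ℕ.≤-refl) (¬Block-π⁻¹ (s≤s⁻¹ lo<u) (ℕ.<-trans ℕ.≤-refl u<hi))
    ...   | inj₂ w≡u = ℕ.≤-reflexive (sym w≡u) , ℕ.≤-trans (s≤s w≤u) (ℕ.<⇒≤ u<hi)
    above⁻ {u} {w} (lo<u , u<hi) u≼w | inj₁ s@(u≤w , _) = u≤w , ℕ.≮⇒≥ absurd
      where
      absurd : ¬ (hi < pos w)
      absurd hi<w = parity-suc-≢ (suc (toℕ i)) (sym (block-unique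
        (span-block s (ℕ.<⇒≤ u<hi) (s≤s⁻¹ hi<w))
        (block 1+i<t ℕ.≤-refl (a<a-suc 1+i<t))))
        where
        -- If the segment were the last one, `hi` would be `a t`, which exceeds every position; so a
        -- next block exists.
        1+i<t = ℕ.≤∧≢⇒< i<t (λ e → ℕ.<-asym hi<w (subst (λ j → pos w < a j) (sym e) (pos<a w)))

    left-end : ∀ {w} → pos w ≡ lo → ext π i ≡ just w
    left-end {w} e with toℕ i in eq
    -- The first segment is excluded since `a 0` is 0 while positions start at 1.
    ... | suc k = IsEnd⇒ext (isEnd (subst (_< t) eq i<t) (ℕ.≤-reflexive eq) (subst (k ≤_) (sym eq) (ℕ.n≤1+n k)) e refl)

    left-end⁻ : ∀ {w} → ext π i ≡ just w → pos w ≡ lo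
    left-end⁻ eq with IsExt⇒IsEnd (ext-sound π i eq)
    ... | isEnd {k} _ i≤k k≤i e p with ℕ.m≤n⇒m<n∨m≡n k≤i
    ...   | inj₁ k<i = trans e (cong a (ℕ.≤-antisym k<i i≤k))
    ...   | inj₂ refl = contradiction p (parity-suc-≢ k)

    right-end : ∀ {w} → pos w ≡ hi → ext (π ⁻¹) i ≡ just w
    right-end {w} e = IsEnd⇒ext (isEnd 1+i<t (ℕ.n≤1+n _) ℕ.≤-refl e (suc-homo-⁻¹ (toℕ i)))
      where
      1+i<t = ℕ.≤∧≢⇒< i<t (λ i≡ → ℕ.<⇒≢ (pos<a w) (trans e (cong a i≡)))

    right-end⁻ : ∀ {w} → ext (π ⁻¹) i ≡ just w → pos w ≡ hi
    right-end⁻ eq with IsExt⇒IsEnd (ext-sound (π ⁻¹) i eq)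
    ... | isEnd {k} _ i≤k k≤i e p with ℕ.m≤n⇒m<n∨m≡n k≤i
    ...   | inj₂ refl = e
    ...   | inj₁ k<i = contradiction
      (trans (cong parity (ℕ.≤-antisym k<i i≤k)) (trans (sym (suc-homo-⁻¹ (toℕ i))) p)) (parity-suc-≢ k)

    module _ (ℓ : ℕ) (α≡ : lookup α i ≡ suc ℓ) (x : Fin n) where

      hi≡ : hi ≡ suc (lo ℕ.+ ℓ)
      hi≡ = trans (a-suc i) (trans (cong (lo ℕ.+_) α≡) (ℕ.+-suc lo ℓ))

      -- x is a junk value for positions past the end of the fence.
      c : ℕ → Fin n
      c j with lo ℕ.+ j ℕ.<? n
      ... | yes lt = fromℕ< lt
      ... | no _   = x

      -- As `pos` is one more than `toℕ`, rung `j` has position `lo + j + 1`, so `c 0` comes right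
      -- after `lo`. It lies in the fence because `lo + ℓ < hi ≤ suc n`.
      toℕ-c : ∀ {j} → j < ℓ → toℕ (c j) ≡ lo ℕ.+ j
      toℕ-c {j} j<ℓ with lo ℕ.+ j ℕ.<? n
      ... | yes lt = Fin.toℕ-fromℕ< lt
      ... | no ≮n  = contradiction (s≤s⁻¹ (begin-strict
              suc (lo ℕ.+ j) ≤⟨ ℕ.+-monoʳ-< lo j<ℓ ⟩
              lo ℕ.+ ℓ       <⟨ ℕ.≤-reflexive (sym hi≡) ⟩
              hi             ≤⟨ a-mono i<t ⟩
              a t            ≡⟨ suc-n ⟨
              suc n          ∎)) ≮n
        where open ℕ.≤-Reasoning

      c-Interior : ∀ {j} → j < ℓ → Interior (c j)
      c-Interior {j} j<ℓ =
        s≤s (subst (lo ≤_) (sym (toℕ-c j<ℓ)) (ℕ.m≤m+n lo j)) ,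
        subst (pos (c j) <_) (sym hi≡) (s≤s (subst (_< lo ℕ.+ ℓ) (sym (toℕ-c j<ℓ)) (ℕ.+-monoʳ-< lo j<ℓ)))

      -- In `Ord π` the segment grows from left to right whatever its slope, so one construction
      -- covers odd and even segments.
      segment-ladder : Ladder (Ord π) (S̆ i) ℓ (ext π i) (ext (π ⁻¹) i)
      segment-ladder = record
        { c       = c
        ; c∈U     = λ j<ℓ → Interior⇒∈S̆ (c-Interior j<ℓ)
        ; rung    = rung
        ; mono    = λ {j} {k} j≤k k<ℓ → let j<ℓ = ℕ.≤-<-trans j≤k k<ℓ in
            Span⇒Ord π (span⁺ (ℕ.<⇒≤ (proj₁ (c-Interior j<ℓ)))
              (subst₂ _≤_ (sym (toℕ-c j<ℓ)) (sym (toℕ-c k<ℓ)) (ℕ.+-monoʳ-≤ lo j≤k))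
              (ℕ.<⇒≤ (proj₂ (c-Interior k<ℓ))))
        ; reflect = λ j<ℓ k<ℓ r → ℕ.+-cancelˡ-≤ lo _ _
            (subst₂ _≤_ (toℕ-c j<ℓ) (toℕ-c k<ℓ) (proj₂ (below⁻ (c-Interior k<ℓ) r)))
        ; below   = below
        ; above   = above
        ; bottom  = λ eq → let w∈ , low = ext-sound π i eq in
            (λ w∈S̆ → x∈p─q⇒x∉q (S i) shared w∈S̆ (proj₂ (x∈p∩q⁻ (S i) shared w∈))) ,
            (λ u∈ → let lo<u , u<hi = ∈S̆⇒Interior u∈ ; w≡lo = left-end⁻ eq in
              Span⇒Ord π (span⁺ (ℕ.≤-reflexive (sym w≡lo)) (s≤s⁻¹ (ℕ.≤-trans (ℕ.≤-reflexive w≡lo) (ℕ.<⇒≤ lo<u))) (ℕ.<⇒≤ u<hi))) ,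
            Low⇒minimal π low
        ; top     = λ eq → let w∈ , low = ext-sound (π ⁻¹) i eq in
            (λ w∈S̆ → x∈p─q⇒x∉q (S i) shared w∈S̆ (proj₂ (x∈p∩q⁻ (S i) shared w∈))) ,
            (λ u∈ → let lo<u , u<hi = ∈S̆⇒Interior u∈ ; w≡hi = right-end⁻ eq in
              Span⇒Ord π (span⁺ (ℕ.<⇒≤ lo<u) (s≤s⁻¹ (ℕ.≤-trans (ℕ.<⇒≤ u<hi) (ℕ.≤-reflexive (sym w≡hi)))) (ℕ.≤-reflexive w≡hi))) ,
            (λ w≼r → Low⇒minimal (π ⁻¹) low (Ord-flip π w≼r))
        }
        where
        rung : ∀ {u} → u ∈ S̆ i → ∃[ j ] j < ℓ × u ≡ c j
        rung {u} u∈ = j , j<ℓ , Fin.toℕ-injective (trans (sym lo+j) (sym (toℕ-c j<ℓ)))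
          where
          lo<u = proj₁ (∈S̆⇒Interior u∈)
          u<hi = proj₂ (∈S̆⇒Interior u∈)
          j = toℕ u ∸ lo
          lo+j : lo ℕ.+ j ≡ toℕ u
          lo+j = ℕ.m+[n∸m]≡n (s≤s⁻¹ lo<u)
          j<ℓ : j < ℓ
          j<ℓ = ℕ.+-cancelˡ-< lo j ℓ (subst (_< lo ℕ.+ ℓ) (sym lo+j) (s≤s⁻¹ (subst (pos u <_) hi≡ u<hi)))
        below : ∀ {u w} → u ∈ S̆ i → Ord π w u → w ∈ S̆ i ⊎ ext π i ≡ just w
        below u∈ w≼u with below⁻ (∈S̆⇒Interior u∈) w≼u
        ... | lo≤w , w≤u with ℕ.m≤n⇒m<n∨m≡n lo≤w
        ...   | inj₁ lo<w = inj₁ (Interior⇒∈S̆ (lo<w , ℕ.≤-<-trans (s≤s w≤u) (proj₂ (∈S̆⇒Interior u∈))))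
        ...   | inj₂ lo≡w = inj₂ (left-end (sym lo≡w))
        above : ∀ {u w} → u ∈ S̆ i → Ord π u w → w ∈ S̆ i ⊎ ext (π ⁻¹) i ≡ just w
        above u∈ u≼w with above⁻ (∈S̆⇒Interior u∈) u≼w
        ... | u≤w , w≤hi with ℕ.m≤n⇒m<n∨m≡n w≤hi
        ...   | inj₁ w<hi = inj₁ (Interior⇒∈S̆ (ℕ.<-≤-trans (proj₁ (∈S̆⇒Interior u∈)) (s≤s u≤w) , w<hi))
        ...   | inj₂ w≡hi = inj₂ (right-end w≡hi)

  -- For even segments `Ord` is the opposite order and the left end is the peak, so the ladder has
  -- to be turned over.
  valley-peak-ladder : ∀ i ℓ → lookup α i ≡ suc ℓ → Fin n → Ladder _⊴_ (S̆ i) ℓ (valley i) (peak i)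
  valley-peak-ladder i ℓ α≡ x with parity (suc (toℕ i)) | Segment.segment-ladder i ℓ α≡ x
  ... | 0ℙ | ladder = reverse ladder
  ... | 1ℙ | ladder = ladder

theorem3p1 : ∀ {m : ℕ} (α : Vec ℕ (2 ℕ.+ m)) → IsFenceShape α →
    let open Fence α in
    (i : Fin t) → 2 ≤ lookup α i →
    (x y z : Fin n) → x ∈ S̆ i →
    NthSmallest 1 (S̆ i) y → NthSmallest (β i) (S̆ i) z →
    ∀ (I : 𝒥) →
    + lookup α i * χ x I + χ′ (valley i) I + χ′ (peak i) I
    ≡ 1ℤ - T′ (valley i) I
    - (∑[ u ∈ [ y , x ] ] (+ ∣ [ y , u ] ∣ * T u I))
    + (∑[ u ∈ ⦅ x , z ] ] (+ ∣ [ u , z ] ∣ * T u I))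
theorem3p1 α shape i 2≤α x y z x∈ y-first z-last I =
  trans (cong (λ k → + k * χ x I + χ′ (valley i) I + χ′ (peak i) I) α≡)
    (Toggling.OnLadder.ladder-toggle isDecPartialOrder
      (FenceSegments.valley-peak-ladder α shape i _ α≡ x) I x∈ y-first z-last)
  where
  open Fence α
  α≡ = sym (ℕ.suc-pred (lookup α i) {{ℕ.>-nonZero (ℕ.<⇒≤ 2≤α)}})
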